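{- $\tau(\log F_4^*)>1$; that is, the set $\log F_4^*=\{\log x : x\in F_4^*\}$ has thickness greater than $1$.
   Context: $F_4^*$ is the set of all irrational numbers $x=[x_0;x_1,x_2,\dots]$ (infinite regular continued fractions) such that $(x_0,x_1)=(4,3)$ and, for all $i\ge 0$: $x_i\in\{1,2,3,4\}$; $(x_i,x_{i+1})\ne(4,4)$; and $(x_i,x_{i+1},x_{i+2},x_{i+3},x_{i+4})\ne(4,1,4,1,4)$. A Cantor-type set on a closed interval $I$ is a set $\mathcal{E}=I\setminus\bigcup_{k} U_k$, where $\{U_k\}_{k\ge 1}$ is a countable family of mutually disjoint open intervals (the gaps). $|A|=\sup A-\inf A$ denotes the length of an interval. Thickness: fix an order $U_1,U_2,\dots$ of the gaps. For each $k$, let $I_k$ be the largest closed interval contained in $\mathcal{E}_k=I\setminus\bigcup_{i=1}^{k-1}U_i$ that contains $U_k$, and let $I_k^1,I_k^2$ be the two maximal closed segments of $I_k\setminus U_k$ adjacent to $U_k$. The thickness $\tau(\mathcal{E})$ is said to be at least $\tau$ if $\tau\cdot|U_k|\le\min\{|I_k^1|,|I_k^2|\}$ for all $k$. Here $\tau(\mathcal{E})\ge\tau$ is understood to mean that this holds for some enumeration of the gaps, and $\tau(\mathcal{E})>1$ means that $\tau(\mathcal{E})\ge\tau$ for some real $\tau>1$. -}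

module Defs where

open import Level using (Level; _⊔_; suc)
open import Algebra.Apartness.Bundles using (HeytingCommutativeRing; HeytingField)
open import Algebra.Bundles using (CommutativeRing)
open import Data.Empty using (⊥-elim)
open import Data.Integer.Base as ℤ using (ℤ; +_; -[1+_])
open import Data.Nat.Base as ℕ using (ℕ; zero)
open import Data.Product.Base using (Σ; ∃; ∃-syntax; _×_; _,_; proj₁; proj₂)
open import Data.Sum.Base using (_⊎_; inj₁; inj₂)
open import Function.Base using (_∘_)
open import Relation.Binary.Core using (Rel)
open import Relation.Binary.PropositionalEquality.Core using (_≡_)
open import Relation.Binary.Structures using (IsStrictPartialOrder)
open import Relation.Nullary.Negation.Core using (¬_)
open import Relation.Unary using (Pred; _∈_; _∉_; _⊆_; _≐_)

import Algebra.Definitions.RawMonoid as RawMonoidOps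
import Algebra.Properties.Ring as RingProperties

------------------------------------------------------------------------
-- The real numbers
--
-- The standard library has no real numbers.  ℝ is therefore described
-- by its usual axioms, as an Archimedean Cauchy-complete ordered field.
-- Classically these axioms have exactly one model up to unique
-- isomorphism; they are phrased so that the constructive (Bishop) reals
-- satisfy them as well.

record RealField (c ℓ₁ ℓ₂ : Level) : Set (suc (c ⊔ ℓ₁ ⊔ ℓ₂)) where
  infix 4 _<_ _≤_ ∣_∣<_
  infix 9 _⁻¹[_]

  field
    heytingField : HeytingField c ℓ₁ ℓ₂

  open HeytingField heytingField public
  open HeytingCommutativeRing heytingCommutativeRing public using (commutativeRing)
  open CommutativeRing commutativeRing public using (ring; +-rawMonoid)
  open RawMonoidOps +-rawMonoid public using () renaming (_×_ to _·_)

  field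
    _<_                  : Rel Carrier ℓ₂
    isStrictPartialOrder : IsStrictPartialOrder _≈_ _<_
    <⇒#                  : ∀ {x y} → x < y → x # y
    #⇒<⊎>                : ∀ {x y} → x # y → x < y ⊎ y < x
    0<1                  : 0# < 1#
    +-monoˡ-<            : ∀ {x y} z → x < y → x + z < y + z
    *-pos                : ∀ {x y} → 0# < x → 0# < y → 0# < x * y
    archimedean          : ∀ x → ∃[ n ] x < n · 1#

  module <-SPO = IsStrictPartialOrder isStrictPartialOrder

  _≤_ : Rel Carrier ℓ₂
  x ≤ y = ¬ (y < x)

  ∣_∣<_ : Rel Carrier ℓ₂
  ∣ x ∣< ε = (- ε < x) × (x < ε)

  Cauchy : (ℕ → Carrier) → Set (c ⊔ ℓ₂)
  Cauchy u = ∀ ε → 0# < ε →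
    ∃[ N ] (∀ m n → N ℕ.≤ m → N ℕ.≤ n → ∣ u m - u n ∣< ε)

  ConvergesTo : (ℕ → Carrier) → Carrier → Set (c ⊔ ℓ₂)
  ConvergesTo u l = ∀ ε → 0# < ε →
    ∃[ N ] (∀ n → N ℕ.≤ n → ∣ u n - l ∣< ε)

  field
    complete : ∀ u → Cauchy u → ∃[ l ] ConvergesTo u l

  fromℕ : ℕ → Carrier
  fromℕ n = n · 1#

  fromℤ : ℤ → Carrier
  fromℤ (+ n)    = fromℕ n
  fromℤ -[1+ n ] = - fromℕ (ℕ.suc n)

  Irrational : Pred Carrier ℓ₁
  Irrational x = ∀ (m : ℤ) (n : ℕ) → ¬ (fromℕ (ℕ.suc n) * x ≈ fromℤ m)

  private
    module RP = RingProperties ring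

    <-resp : ∀ {x x′ y y′} → x ≈ x′ → y ≈ y′ → x < y → x′ < y′
    <-resp x≈x′ y≈y′ x<y = <-SPO.<-respʳ-≈ y≈y′ (<-SPO.<-respˡ-≈ x≈x′ x<y)

    x-0≈x : ∀ x → x - 0# ≈ x
    x-0≈x x = trans (+-congˡ RP.-0#≈0#) (+-identityʳ x)

  +-pos : ∀ {x y} → 0# < x → 0# < y → 0# < x + y
  +-pos {x} {y} 0<x 0<y =
    <-SPO.trans 0<y (<-resp (+-identityˡ y) refl (+-monoˡ-< y 0<x))

  private
    inverse : ∀ x → 0# < x → ∃[ y ] x * y ≈ 1#
    inverse x 0<x with #⇒invertible (#-sym (<⇒# 0<x))
    ... | y , _ , x-0*y≈1 = y , trans (*-congʳ (sym (x-0≈x x))) x-0*y≈1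

  _⁻¹[_] : ∀ x → 0# < x → Carrier
  x ⁻¹[ 0<x ] = proj₁ (inverse x 0<x)

  *-inverseʳ : ∀ x (0<x : 0# < x) → x * x ⁻¹[ 0<x ] ≈ 1#
  *-inverseʳ x 0<x = proj₂ (inverse x 0<x)

  ⁻¹-pos : ∀ x (0<x : 0# < x) → 0# < x ⁻¹[ 0<x ]
  ⁻¹-pos x 0<x with #⇒<⊎> (invertible⇒# {x ⁻¹[ 0<x ]} {0#}
      ( x
      , trans (*-congˡ (x-0≈x _)) (*-inverseʳ x 0<x)
      , trans (*-congʳ (x-0≈x _)) (trans (*-comm _ x) (*-inverseʳ x 0<x))))
  ... | inj₂ 0<y = 0<y
  ... | inj₁ y<0 = ⊥-elim (<-SPO.irrefl refl
      (<-resp refl (-‿inverseʳ 1#) (+-pos 0<1 0<-1)))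
    where
    y = x ⁻¹[ 0<x ]

    0<-y : 0# < - y
    0<-y = <-resp (-‿inverseʳ y) (+-identityˡ (- y)) (+-monoˡ-< (- y) y<0)

    0<-1 : 0# < - 1#
    0<-1 = <-resp refl
      (trans (sym (RP.-‿distribʳ-* x y)) (-‿cong (*-inverseʳ x 0<x)))
      (*-pos 0<x 0<-y)

  fromℕ-pos : ∀ n → 1 ℕ.≤ n → 0# < fromℕ n
  fromℕ-pos (ℕ.suc zero)        _ = <-resp refl (sym (+-identityʳ 1#)) 0<1
  fromℕ-pos (ℕ.suc (ℕ.suc n))   _ =
    +-pos 0<1 (fromℕ-pos (ℕ.suc n) (ℕ.s≤s ℕ.z≤n))

-- The functional equation determines log up to the choice of base; the
-- bound log x ≤ x - 1 (equivalently, derivative 1 at the point 1) fixes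
-- the base to be e.

record NaturalLogarithm {c ℓ₁ ℓ₂ : Level} (ℝ : RealField c ℓ₁ ℓ₂)
       : Set (c ⊔ ℓ₁ ⊔ ℓ₂) where
  open RealField ℝ
  field
    log      : ∀ x → 0# < x → Carrier
    log-cong : ∀ {x y} (0<x : 0# < x) (0<y : 0# < y) →
               x ≈ y → log x 0<x ≈ log y 0<y
    log-*    : ∀ x y (0<x : 0# < x) (0<y : 0# < y) →
               log (x * y) (*-pos 0<x 0<y) ≈ log x 0<x + log y 0<y
    log≤x-1  : ∀ x (0<x : 0# < x) → log x 0<x ≤ x - 1#

  logImage : ∀ {ℓ} → Pred Carrier ℓ → Pred Carrier (c ⊔ ℓ₁ ⊔ ℓ₂ ⊔ ℓ)
  logImage S y = ∃[ x ] Σ (0# < x) λ 0<x → x ∈ S × y ≈ log x 0<x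

------------------------------------------------------------------------
-- Continued fractions and the set F₄*

module ContinuedFractions {c ℓ₁ ℓ₂ : Level} (ℝ : RealField c ℓ₁ ℓ₂) where
  open RealField ℝ

  -- [ a₀ ; a₁ , … , aₙ ], together with the positivity needed to take
  -- its reciprocal in the next step.
  finiteCF⁺ : (a : ℕ → ℕ) → (∀ i → 1 ℕ.≤ a i) → ℕ → ∃[ x ] 0# < x
  finiteCF⁺ a a≥1 zero      = fromℕ (a 0) , fromℕ-pos (a 0) (a≥1 0)
  finiteCF⁺ a a≥1 (ℕ.suc n) =
    let x , 0<x = finiteCF⁺ (a ∘ ℕ.suc) (a≥1 ∘ ℕ.suc) n
    in  fromℕ (a 0) + x ⁻¹[ 0<x ]
      , +-pos (fromℕ-pos (a 0) (a≥1 0)) (⁻¹-pos x 0<x)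

  finiteCF : (a : ℕ → ℕ) → (∀ i → 1 ℕ.≤ a i) → ℕ → Carrier
  finiteCF a a≥1 n = proj₁ (finiteCF⁺ a a≥1 n)

  -- x = [ a₀ ; a₁ , a₂ , … ]
  IsCFExpansionOf : (a : ℕ → ℕ) → (∀ i → 1 ℕ.≤ a i) →
                    Carrier → Set (c ⊔ ℓ₂)
  IsCFExpansionOf a a≥1 x = ConvergesTo (finiteCF a a≥1) x

  record F₄*-Digits (a : ℕ → ℕ) : Set where
    field
      a₀≡4     : a 0 ≡ 4
      a₁≡3     : a 1 ≡ 3
      a≥1      : ∀ i → 1 ℕ.≤ a i
      a≤4      : ∀ i → a i ℕ.≤ 4
      no-44    : ∀ i → ¬ (a i ≡ 4 × a (1 ℕ.+ i) ≡ 4)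
      no-41414 : ∀ i → ¬ (a i ≡ 4 × a (1 ℕ.+ i) ≡ 1 × a (2 ℕ.+ i) ≡ 4 ×
                          a (3 ℕ.+ i) ≡ 1 × a (4 ℕ.+ i) ≡ 4)

  F₄* : Pred Carrier (c ⊔ ℓ₁ ⊔ ℓ₂)
  F₄* x = Irrational x ×
    (∃[ a ] Σ (F₄*-Digits a) λ d → IsCFExpansionOf a (F₄*-Digits.a≥1 d) x)

------------------------------------------------------------------------
-- Cantor-type sets and thickness

module Thickness {c ℓ₁ ℓ₂ : Level} (ℝ : RealField c ℓ₁ ℓ₂) where
  open RealField ℝ

  record ClosedInterval : Set (c ⊔ ℓ₂) where
    constructor [_,_]⟨_⟩
    field
      lo    : Carrier
      hi    : Carrier
      lo≤hi : lo ≤ hi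

  record OpenInterval : Set (c ⊔ ℓ₂) where
    constructor ⦅_,_⦆⟨_⟩
    field
      lo    : Carrier
      hi    : Carrier
      lo<hi : lo < hi

  open ClosedInterval using () renaming (lo to min; hi to max)
  open OpenInterval   using () renaming (lo to inf; hi to sup)

  ⟦_⟧ : ClosedInterval → Pred Carrier ℓ₂
  ⟦ J ⟧ y = min J ≤ y × y ≤ max J

  ⟪_⟫ : OpenInterval → Pred Carrier ℓ₂
  ⟪ V ⟫ y = inf V < y × y < sup V

  ∣_∣ : OpenInterval → Carrier
  ∣ V ∣ = sup V - inf V

  -- Gaps are numbered from 0.

  Disjoint : (ℕ → OpenInterval) → Set (c ⊔ ℓ₂)
  Disjoint U = ∀ i j → ¬ (i ≡ j) → ∀ {y} → y ∈ ⟪ U i ⟫ → y ∉ ⟪ U j ⟫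

  -- I ∖ (U₀ ∪ … ∪ Uₖ₋₁)
  Stage : ClosedInterval → (ℕ → OpenInterval) → ℕ → Pred Carrier ℓ₂
  Stage I U k y = y ∈ ⟦ I ⟧ × (∀ i → i ℕ.< k → y ∉ ⟪ U i ⟫)

  record IsCantorType {ℓ} (E : Pred Carrier ℓ)
         (I : ClosedInterval) (U : ℕ → OpenInterval)
         : Set (c ⊔ ℓ₂ ⊔ ℓ) where
    field
      disjoint   : Disjoint U
      complement : E ≐ (λ y → y ∈ ⟦ I ⟧ × (∀ k → y ∉ ⟪ U k ⟫))

  record IsLargestAround (S : Pred Carrier ℓ₂) (V : OpenInterval)
         (J : ClosedInterval) : Set (c ⊔ ℓ₂) where
    field
      inside   : ⟦ J ⟧ ⊆ S
      contains : ⟪ V ⟫ ⊆ ⟦ J ⟧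
      largest  : ∀ J′ → ⟦ J′ ⟧ ⊆ S → ⟪ V ⟫ ⊆ ⟦ J′ ⟧ → ⟦ J′ ⟧ ⊆ ⟦ J ⟧

  -- J ∖ V consists of the two segments [ min J , inf V ] and
  -- [ sup V , max J ]; an inequality t ≤ min { s₁ , s₂ } is written
  -- t ≤ s₁ × t ≤ s₂.
  GapBound : Carrier → ClosedInterval → (ℕ → OpenInterval) → ℕ →
             Set (c ⊔ ℓ₂)
  GapBound τ I U k = ∃[ J ] IsLargestAround (Stage I U k) (U k) J
    × τ * ∣ U k ∣ ≤ inf (U k) - min J
    × τ * ∣ U k ∣ ≤ max J - sup (U k)

  ThicknessAtLeast : ∀ {ℓ} → Carrier → Pred Carrier ℓ → Set (c ⊔ ℓ₂ ⊔ ℓ)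
  ThicknessAtLeast τ E =
    ∃[ I ] ∃[ U ] IsCantorType E I U × (∀ k → GapBound τ I U k)

  ThicknessExceedsOne : ∀ {ℓ} → Pred Carrier ℓ → Set (c ⊔ ℓ₂ ⊔ ℓ)
  ThicknessExceedsOne E = ∃[ τ ] 1# < τ × ThicknessAtLeast τ E

{-# OPTIONS --safe #-}

-- The set is cut out by a binary tree of intervals.  After a prefix of a
-- continued fraction, the allowed values of the next digit are separated
-- one at a time, from the smallest to the largest, so every gap lies
-- between the sequences continuing with d and those continuing with a
-- digit > d.  In a breadth-first enumeration of the gaps, the component of
-- a gap is the interval of its vertex in the tree.
--
-- A prefix acts on the tail t by t ↦ (u t + u′) / (v t + v′) with
-- u v′ − u′ v = ± 1.  For a gap ( a , b ) and a neighbouring bridge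
-- [ b , h ] in the coordinate t, the bounds 1 − 1 / z ≤ log z ≤ z − 1
-- reduce the comparison of their logarithmic lengths to
-- τ (b − a) (u h + u′) ≤ (h − b) (u a + u′).  The extreme tails only
-- depend on which of the suffixes 4, 41, 414, 4141 precedes, so this is a
-- finite list of numerical inequalities.  It holds with τ = 101 / 100 for
-- all u , u′ ≥ 0, except for the gap between 3 and 4 after 41, where one
-- needs 4 u ≤ 5 u′, a consequence of the preceding digits 4, 1.

module Submission where

open import Defs
open import Algebra.Solver.Ring.AlmostCommutativeRing
  using (AlmostCommutativeRing; fromCommutativeRing; _-Raw-AlmostCommutative⟶_)
import Algebra.Properties.Ring as RingProperties
import Algebra.Properties.Semiring.Mult as SemiringMult
import Algebra.Solver.Ring as RingSolver
open import Data.Bool.Base using (Bool; true; false; not; if_then_else_; _xor_)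
open import Data.Empty using (⊥; ⊥-elim)
open import Data.Integer.Base as ℤ using (ℤ; +_; -[1+_]; _⊖_)
import Data.Integer.Properties as ℤ
open import Data.List.Base using (List; []; _∷_; _++_; _∷ʳ_; _∷ʳ′_; initLast)
open import Data.List.Properties using (∷ʳ-++; ++-identityʳ)
open import Data.Maybe.Base using (Maybe; just; nothing)
open import Data.Nat.Base as ℕ using (ℕ)
open import Data.Nat.DivMod using (_/_; m/n*n≤m; m≡m%n+[m/n]*n; m%n<n)
import Data.Nat.Properties as ℕ
open import Data.Nat.Solver using (module +-*-Solver)
open import Data.Product.Base using (∃-syntax; _×_; _,_; proj₁; proj₂)
import Data.Sign.Base as Sign
open import Data.Sum.Base using (_⊎_; inj₁; inj₂)
open import Data.Unit.Base using (⊤; tt)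
open import Function.Base using (_∘_)
open import Level using (_⊔_)
open import Relation.Binary.PropositionalEquality.Core as ≡ using (_≡_)
open import Relation.Nullary.Decidable.Core using (Dec; yes; no; toWitness; _×-dec_)
open import Relation.Nullary.Negation.Core using (¬_)
open import Relation.Unary using (Pred; _∈_; _∉_; _⊆_)

-- Let f be the logarithm of a Möbius map of determinant 1. Then f b - f a lies between (b - a) /
-- ((u b + u′)(v a + v′)) and (b - a) / ((u a + u′)(v b + v′)). Against the bridge above a gap the
-- factor v b + v′ cancels, which is why only u and u′ survive. Against the bridge below it u a + u′
-- cancels and the denominators compare by monotonicity, so this side is a condition on the tails
-- alone. The other obstacle is to identify the set left by the tree with the logarithms of F₄*, in
-- a field where reals cannot be compared by cases. A point that avoids a gap is placed on one side
-- of it by cotransitivity between the two ends of the gap; this yields its digits one by one. After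
-- n digits the interval has length at most 5 / n, so by the Archimedean property the point is the
-- logarithm of the continued fraction found. Conversely, the path of a given continued fraction is
-- decided by comparing digits, which are natural numbers.

-- Arithmetic and order in the real field

module OrderedField {c ℓ₁ ℓ₂} (ℝ : RealField c ℓ₁ ℓ₂) where
  open RealField ℝ hiding (zero)
  open RingProperties ring using (-0#≈0#; -‿involutive; -‿distribˡ-*; -‿distribʳ-*)
  open import Relation.Binary.Reasoning.Setoid setoid

  fromℕ-+ : ∀ m n → fromℕ (m ℕ.+ n) ≈ fromℕ m + fromℕ n
  fromℕ-+ m n = SemiringMult.×-homo-+ semiring′ 1# m n
    where semiring′ = AlmostCommutativeRing.semiring (fromCommutativeRing commutativeRing)

  fromℕ-* : ∀ m n → fromℕ (m ℕ.* n) ≈ fromℕ m * fromℕ n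
  fromℕ-* m n = SemiringMult.×1-homo-* semiring′ m n
    where semiring′ = AlmostCommutativeRing.semiring (fromCommutativeRing commutativeRing)

  private
    +-cancel-1 : ∀ x y → (1# + x) - (1# + y) ≈ x - y
    +-cancel-1 x y = begin
      (1# + x) - (1# + y)        ≈⟨ +-congˡ (sym (AlmostCommutativeRing.-‿+-comm acr 1# y)) ⟩
      (1# + x) + (- 1# - y)      ≈⟨ +-assoc _ _ _ ⟩
      1# + (x + (- 1# - y))      ≈⟨ +-congˡ (trans (sym (+-assoc _ _ _)) (trans (+-congʳ (+-comm _ _)) (+-assoc _ _ _))) ⟩
      1# + (- 1# + (x - y))      ≈⟨ +-assoc _ _ _ ⟨
      (1# - 1#) + (x - y)        ≈⟨ +-congʳ (-‿inverseʳ 1#) ⟩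
      0# + (x - y)               ≈⟨ +-identityˡ _ ⟩
      x - y                      ∎
      where acr = fromCommutativeRing commutativeRing

  fromℤ-⊖ : ∀ m n → fromℤ (m ⊖ n) ≈ fromℕ m - fromℕ n
  fromℤ-⊖ m ℕ.zero = sym (trans (+-congˡ -0#≈0#) (+-identityʳ _))
  fromℤ-⊖ ℕ.zero (ℕ.suc n) = sym (+-identityˡ _)
  fromℤ-⊖ (ℕ.suc m) (ℕ.suc n) = begin
    fromℤ (ℕ.suc m ⊖ ℕ.suc n)  ≡⟨ ≡.cong fromℤ (ℤ.[1+m]⊖[1+n]≡m⊖n m n) ⟩
    fromℤ (m ⊖ n)              ≈⟨ fromℤ-⊖ m n ⟩
    fromℕ m - fromℕ n          ≈⟨ +-cancel-1 _ _ ⟨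
    fromℕ (ℕ.suc m) - fromℕ (ℕ.suc n) ∎

  fromℤ-neg : ∀ i → fromℤ (ℤ.- i) ≈ - fromℤ i
  fromℤ-neg (+ ℕ.zero)    = sym -0#≈0#
  fromℤ-neg (+ (ℕ.suc n)) = refl
  fromℤ-neg -[1+ n ]      = sym (-‿involutive _)

  fromℤ-+ : ∀ i j → fromℤ (i ℤ.+ j) ≈ fromℤ i + fromℤ j
  fromℤ-+ (+ m)    (+ n)    = fromℕ-+ m n
  fromℤ-+ (+ m)    -[1+ n ] = fromℤ-⊖ m (ℕ.suc n)
  fromℤ-+ -[1+ m ] (+ n)    = trans (fromℤ-⊖ n (ℕ.suc m)) (+-comm _ _)
  fromℤ-+ -[1+ m ] -[1+ n ] = begin
    - fromℕ (ℕ.suc (ℕ.suc (m ℕ.+ n)))         ≡⟨ ≡.cong (λ k → - fromℕ (ℕ.suc k)) (ℕ.+-suc m n) ⟨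
    - fromℕ (ℕ.suc m ℕ.+ ℕ.suc n)             ≈⟨ -‿cong (fromℕ-+ (ℕ.suc m) (ℕ.suc n)) ⟩
    - (fromℕ (ℕ.suc m) + fromℕ (ℕ.suc n))     ≈⟨ AlmostCommutativeRing.-‿+-comm (fromCommutativeRing commutativeRing) _ _ ⟨
    - fromℕ (ℕ.suc m) - fromℕ (ℕ.suc n)       ∎

  private
    fromℤ-neg* : ∀ m n → fromℤ (Sign.- ℤ.◃ m ℕ.* n) ≈ - (fromℕ m * fromℕ n)
    fromℤ-neg* m n = begin
      fromℤ (Sign.- ℤ.◃ m ℕ.* n) ≡⟨ ≡.cong fromℤ (ℤ.-◃n≡-n (m ℕ.* n)) ⟩
      fromℤ (ℤ.- (+ (m ℕ.* n)))  ≈⟨ fromℤ-neg (+ (m ℕ.* n)) ⟩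
      - fromℕ (m ℕ.* n)          ≈⟨ -‿cong (fromℕ-* m n) ⟩
      - (fromℕ m * fromℕ n)      ∎

  fromℤ-* : ∀ i j → fromℤ (i ℤ.* j) ≈ fromℤ i * fromℤ j
  fromℤ-* (+ m)    (+ n)    = trans (reflexive (≡.cong fromℤ (ℤ.+◃n≡+n (m ℕ.* n)))) (fromℕ-* m n)
  fromℤ-* (+ m)    -[1+ n ] = trans (fromℤ-neg* m (ℕ.suc n)) (-‿distribʳ-* _ _)
  fromℤ-* -[1+ m ] (+ n)    = trans (fromℤ-neg* (ℕ.suc m) n) (-‿distribˡ-* _ _)
  fromℤ-* -[1+ m ] -[1+ n ] = begin
    fromℕ (ℕ.suc m ℕ.* ℕ.suc n)               ≈⟨ fromℕ-* (ℕ.suc m) (ℕ.suc n) ⟩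
    fromℕ (ℕ.suc m) * fromℕ (ℕ.suc n)         ≈⟨ -‿involutive _ ⟨
    - - (fromℕ (ℕ.suc m) * fromℕ (ℕ.suc n))   ≈⟨ -‿cong (-‿distribʳ-* _ _) ⟩
    - (fromℕ (ℕ.suc m) * - fromℕ (ℕ.suc n))   ≈⟨ -‿distribˡ-* _ _ ⟩
    - fromℕ (ℕ.suc m) * - fromℕ (ℕ.suc n)     ∎

  private
    -- Equality of reals is undecidable, so the ring solver runs on integer coefficients, whose
    -- equality it can test; this is what lets it compute with numerals.
    fromℤ-morphism : ℤ.+-*-rawRing -Raw-AlmostCommutative⟶ fromCommutativeRing commutativeRing
    fromℤ-morphism = record
      { ⟦_⟧    = fromℤ
      ; +-homo = fromℤ-+
      ; *-homo = fromℤ-*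
      ; -‿homo = fromℤ-neg
      ; 0-homo = refl
      ; 1-homo = +-identityʳ 1#
      }

    _coeff≟_ : ∀ i j → Maybe (fromℤ i ≈ fromℤ j)
    i coeff≟ j with i ℤ.≟ j
    ... | yes i≡j = just (reflexive (≡.cong fromℤ i≡j))
    ... | no  _   = nothing

  open RingSolver ℤ.+-*-rawRing (fromCommutativeRing commutativeRing) fromℤ-morphism _coeff≟_ public
    using (solve; con; _:=_; _:+_; _:*_; _:-_; :-_)

  <-resp : ∀ {x x′ y y′} → x ≈ x′ → y ≈ y′ → x < y → x′ < y′
  <-resp x≈x′ y≈y′ x<y = <-SPO.<-respʳ-≈ y≈y′ (<-SPO.<-respˡ-≈ x≈x′ x<y)

  ≤-resp : ∀ {x x′ y y′} → x ≈ x′ → y ≈ y′ → x ≤ y → x′ ≤ y′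
  ≤-resp x≈x′ y≈y′ x≤y y′<x′ = x≤y (<-resp (sym y≈y′) (sym x≈x′) y′<x′)

  <-irrefl : ∀ {x} → ¬ (x < x)
  <-irrefl = <-SPO.irrefl refl

  <-trans : ∀ {x y z} → x < y → y < z → x < z
  <-trans = <-SPO.trans

  -- The substitute for trichotomy: apartness is cotransitive, and each apartness refines to a
  -- strict inequality.
  <-cotrans : ∀ {x y} → x < y → ∀ z → x < z ⊎ z < y
  <-cotrans x<y z with #-cotrans (<⇒# x<y) z
  <-cotrans x<y z | inj₁ x#z with #⇒<⊎> x#z
  ... | inj₁ x<z = inj₁ x<z
  ... | inj₂ z<x = inj₂ (<-trans z<x x<y)
  <-cotrans x<y z | inj₂ z#y with #⇒<⊎> z#y
  ... | inj₁ z<y = inj₂ z<y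
  ... | inj₂ y<z = inj₁ (<-trans x<y y<z)

  ≤-refl : ∀ {x} → x ≤ x
  ≤-refl = <-irrefl

  ≤-reflexive : ∀ {x y} → x ≈ y → x ≤ y
  ≤-reflexive x≈y = ≤-resp refl x≈y ≤-refl

  <⇒≤ : ∀ {x y} → x < y → x ≤ y
  <⇒≤ x<y y<x = <-irrefl (<-trans x<y y<x)

  ≤-<-trans : ∀ {x y z} → x ≤ y → y < z → x < z
  ≤-<-trans {x} x≤y y<z with <-cotrans y<z x
  ... | inj₁ y<x = ⊥-elim (x≤y y<x)
  ... | inj₂ x<z = x<z

  <-≤-trans : ∀ {x y z} → x < y → y ≤ z → x < z
  <-≤-trans {z = z} x<y y≤z with <-cotrans x<y z
  ... | inj₁ x<z = x<z
  ... | inj₂ z<y = ⊥-elim (y≤z z<y)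

  ≤-trans : ∀ {x y z} → x ≤ y → y ≤ z → x ≤ z
  ≤-trans x≤y y≤z z<x = x≤y (≤-<-trans y≤z z<x)

  ≤-antisym : ∀ {x y} → x ≤ y → y ≤ x → x ≈ y
  ≤-antisym {x} {y} x≤y y≤x = proj₁ (tight x y) λ x#y → case (#⇒<⊎> x#y)
    where
    case : x < y ⊎ y < x → ⊥
    case (inj₁ x<y) = y≤x x<y
    case (inj₂ y<x) = x≤y y<x

  x<y⇒0<y-x : ∀ {x y} → x < y → 0# < y - x
  x<y⇒0<y-x {x} x<y = <-resp (-‿inverseʳ x) refl (+-monoˡ-< (- x) x<y)

  0<y-x⇒x<y : ∀ {x y} → 0# < y - x → x < y
  0<y-x⇒x<y {x} {y} 0<y-x = <-resp (+-identityˡ x)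
    (solve 2 (λ x y → (y :- x) :+ x := y) refl x y) (+-monoˡ-< x 0<y-x)

  x≤y⇒0≤y-x : ∀ {x y} → x ≤ y → 0# ≤ y - x
  x≤y⇒0≤y-x {x} {y} x≤y y-x<0 = x≤y (<-resp
    (solve 2 (λ x y → (y :- x) :+ x := y) refl x y) (+-identityˡ x) (+-monoˡ-< x y-x<0))

  0≤y-x⇒x≤y : ∀ {x y} → 0# ≤ y - x → x ≤ y
  0≤y-x⇒x≤y {x} {y} 0≤y-x y<x = 0≤y-x (<-resp refl (-‿inverseʳ x) (+-monoˡ-< (- x) y<x))

  ≤-by : ∀ {x y e} → 0# ≤ e → y - x ≈ e → x ≤ y
  ≤-by 0≤e y-x≈e = 0≤y-x⇒x≤y (≤-resp refl (sym y-x≈e) 0≤e)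

  <-by : ∀ {x y e} → 0# < e → y - x ≈ e → x < y
  <-by 0<e y-x≈e = 0<y-x⇒x<y (<-resp refl (sym y-x≈e) 0<e)

  +-monoˡ-≤ : ∀ {x y} z → x ≤ y → x + z ≤ y + z
  +-monoˡ-≤ {x} {y} z x≤y = ≤-by (x≤y⇒0≤y-x x≤y)
    (solve 3 (λ x y z → (y :+ z) :- (x :+ z) := y :- x) refl x y z)

  +-monoʳ-≤ : ∀ {x y} z → x ≤ y → z + x ≤ z + y
  +-monoʳ-≤ z x≤y = ≤-resp (+-comm _ _) (+-comm _ _) (+-monoˡ-≤ z x≤y)

  +-mono-≤ : ∀ {x y x′ y′} → x ≤ y → x′ ≤ y′ → x + x′ ≤ y + y′
  +-mono-≤ x≤y x′≤y′ = ≤-trans (+-monoˡ-≤ _ x≤y) (+-monoʳ-≤ _ x′≤y′)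

  +-nonneg : ∀ {x y} → 0# ≤ x → 0# ≤ y → 0# ≤ x + y
  +-nonneg 0≤x 0≤y = ≤-resp (+-identityˡ 0#) refl (+-mono-≤ 0≤x 0≤y)

  +-pos-nonneg : ∀ {x y} → 0# < x → 0# ≤ y → 0# < x + y
  +-pos-nonneg {x} {y} 0<x 0≤y = ≤-<-trans 0≤y (<-resp (+-identityˡ y) refl (+-monoˡ-< y 0<x))

  +-nonneg-pos : ∀ {x y} → 0# ≤ x → 0# < y → 0# < x + y
  +-nonneg-pos 0≤x 0<y = <-resp refl (+-comm _ _) (+-pos-nonneg 0<y 0≤x)

  -- There is no case split on 0 < x, but the goal is a contradiction, so double negation suffices:
  -- a factor that is not positive is 0 by antisymmetry, and then so is the product.
  *-nonneg : ∀ {x y} → 0# ≤ x → 0# ≤ y → 0# ≤ x * y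
  *-nonneg {x} {y} 0≤x 0≤y xy<0 = x≯0 λ 0<x → y≯0 λ 0<y → <-irrefl (<-trans xy<0 (*-pos 0<x 0<y))
    where
    x≯0 : ¬ ¬ (0# < x)
    x≯0 x≤0 = <-irrefl (<-resp (trans (*-congʳ (≤-antisym x≤0 0≤x)) (zeroˡ y)) refl xy<0)
    y≯0 : ¬ ¬ (0# < y)
    y≯0 y≤0 = <-irrefl (<-resp (trans (*-congˡ (≤-antisym y≤0 0≤y)) (zeroʳ x)) refl xy<0)

  *-monoˡ-≤ : ∀ {x y} z → 0# ≤ z → x ≤ y → z * x ≤ z * y
  *-monoˡ-≤ {x} {y} z 0≤z x≤y = ≤-by (*-nonneg 0≤z (x≤y⇒0≤y-x x≤y))
    (solve 3 (λ x y z → z :* y :- z :* x := z :* (y :- x)) refl x y z)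

  *-monoʳ-≤ : ∀ {x y} z → 0# ≤ z → x ≤ y → x * z ≤ y * z
  *-monoʳ-≤ z 0≤z x≤y = ≤-resp (*-comm _ _) (*-comm _ _) (*-monoˡ-≤ z 0≤z x≤y)

  *-mono-≤ : ∀ {x y x′ y′} → 0# ≤ x → 0# ≤ y′ → x ≤ y → x′ ≤ y′ → x * x′ ≤ y * y′
  *-mono-≤ 0≤x 0≤y′ x≤y x′≤y′ = ≤-trans (*-monoˡ-≤ _ 0≤x x′≤y′) (*-monoʳ-≤ _ 0≤y′ x≤y)

  *-monoˡ-< : ∀ {x y} z → 0# < z → x < y → z * x < z * y
  *-monoˡ-< {x} {y} z 0<z x<y = <-by (*-pos 0<z (x<y⇒0<y-x x<y))
    (solve 3 (λ x y z → z :* y :- z :* x := z :* (y :- x)) refl x y z)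

  *-cancelˡ-≤ : ∀ {x y} z → 0# < z → z * x ≤ z * y → x ≤ y
  *-cancelˡ-≤ z 0<z zx≤zy y<x = zx≤zy (*-monoˡ-< z 0<z y<x)

  *-cancelˡ-< : ∀ {x y} z → 0# < z → z * x < z * y → x < y
  *-cancelˡ-< {x} {y} z 0<z zx<zy =
    <-resp (undo x) (undo y) (*-monoˡ-< (z ⁻¹[ 0<z ]) (⁻¹-pos z 0<z) zx<zy)
    where
    undo : ∀ w → z ⁻¹[ 0<z ] * (z * w) ≈ w
    undo w = begin
      z ⁻¹[ 0<z ] * (z * w) ≈⟨ solve 3 (λ z i w → i :* (z :* w) := (z :* i) :* w) refl z _ w ⟩
      (z * z ⁻¹[ 0<z ]) * w ≈⟨ *-congʳ (*-inverseʳ z 0<z) ⟩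
      1# * w                ≈⟨ *-identityˡ w ⟩
      w                     ∎

  *-⁻¹-cancel : ∀ x (0<x : 0# < x) y → x * (y * x ⁻¹[ 0<x ]) ≈ y
  *-⁻¹-cancel x 0<x y = begin
    x * (y * x ⁻¹[ 0<x ]) ≈⟨ solve 3 (λ x i y → x :* (y :* i) := (x :* i) :* y) refl x _ y ⟩
    (x * x ⁻¹[ 0<x ]) * y ≈⟨ *-congʳ (*-inverseʳ x 0<x) ⟩
    1# * y                ≈⟨ *-identityˡ y ⟩
    y                     ∎

  *-cancelˡ-≈ : ∀ {x y} z → 0# < z → z * x ≈ z * y → x ≈ y
  *-cancelˡ-≈ z 0<z zx≈zy = ≤-antisym
    (*-cancelˡ-≤ z 0<z (≤-reflexive zx≈zy)) (*-cancelˡ-≤ z 0<z (≤-reflexive (sym zx≈zy)))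

  -‿mono-≤ : ∀ {x y} → x ≤ y → - y ≤ - x
  -‿mono-≤ {x} {y} x≤y = ≤-by (x≤y⇒0≤y-x x≤y) (solve 2 (λ x y → :- x :- (:- y) := y :- x) refl x y)

  -‿mono-< : ∀ {x y} → x < y → - y < - x
  -‿mono-< {x} {y} x<y = <-by (x<y⇒0<y-x x<y) (solve 2 (λ x y → :- x :- (:- y) := y :- x) refl x y)

  fromℕ-nonneg : ∀ n → 0# ≤ fromℕ n
  fromℕ-nonneg ℕ.zero    = ≤-refl
  fromℕ-nonneg (ℕ.suc n) = <⇒≤ (fromℕ-pos (ℕ.suc n) (ℕ.s≤s ℕ.z≤n))

  fromℕ-mono-≤ : ∀ {m n} → m ℕ.≤ n → fromℕ m ≤ fromℕ n
  fromℕ-mono-≤ {n = n} ℕ.z≤n = fromℕ-nonneg n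
  fromℕ-mono-≤ (ℕ.s≤s m≤n)   = +-monoʳ-≤ 1# (fromℕ-mono-≤ m≤n)

  fromℕ-cancel-< : ∀ {m n} → fromℕ m < fromℕ n → m ℕ.< n
  fromℕ-cancel-< fm<fn = ℕ.≰⇒> λ n≤m → fromℕ-mono-≤ n≤m fm<fn

  fromℕ-1 : fromℕ 1 ≈ 1#
  fromℕ-1 = +-identityʳ 1#

  midpoint : ∀ {x y} → x < y → ∃[ m ] x < m × m < y
  midpoint {x} {y} x<y = (x + y) * h ,
    *-cancelˡ-< 2ᴿ 0<2 (<-by (x<y⇒0<y-x x<y) (trans (+-congʳ 2m)
      (solve 2 (λ x y → (x :+ y) :- con (+ 2) :* x := y :- x) refl x y))) ,
    *-cancelˡ-< 2ᴿ 0<2 (<-by (x<y⇒0<y-x x<y) (trans (+-congˡ (-‿cong 2m))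
      (solve 2 (λ x y → con (+ 2) :* y :- (x :+ y) := y :- x) refl x y)))
    where
    2ᴿ = fromℕ 2
    0<2 = fromℕ-pos 2 (ℕ.s≤s ℕ.z≤n)
    h = 2ᴿ ⁻¹[ 0<2 ]
    2m : 2ᴿ * ((x + y) * h) ≈ x + y
    2m = *-⁻¹-cancel 2ᴿ 0<2 (x + y)

-- Two-sided bounds for differences of logarithms

module LogInequalities {c ℓ₁ ℓ₂} {ℝ : RealField c ℓ₁ ℓ₂} (ln : NaturalLogarithm ℝ) where
  open RealField ℝ hiding (zero)
  open OrderedField ℝ
  open NaturalLogarithm ln

  -- This is log z ≤ z - 1 at z = y / x, multiplied by x.
  log-upper : ∀ {x y} (0<x : 0# < x) (0<y : 0# < y) → x * (log y 0<y - log x 0<x) ≤ y - x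
  log-upper {x} {y} 0<x 0<y = ≤-resp (*-congˡ (sym Δ≈log-z)) (sym x[z-1]≈y-x)
    (*-monoˡ-≤ x (<⇒≤ 0<x) (log≤x-1 z 0<z))
    where
    i = x ⁻¹[ 0<x ]
    z = y * i
    0<z = *-pos 0<y (⁻¹-pos x 0<x)
    xz≈y : x * z ≈ y
    xz≈y = trans (solve 3 (λ x y i → x :* (y :* i) := (x :* i) :* y) refl x y i)
                 (trans (*-congʳ (*-inverseʳ x 0<x)) (*-identityˡ y))
    x[z-1]≈y-x : y - x ≈ x * (z - 1#)
    x[z-1]≈y-x = trans (+-cong (sym xz≈y) (-‿cong (sym (*-identityʳ x))))
      (solve 3 (λ x z o → x :* z :- x :* o := x :* (z :- o)) refl x z 1#)
    Δ≈log-z : log y 0<y - log x 0<x ≈ log z 0<z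
    Δ≈log-z = trans
      (+-congʳ (trans (log-cong 0<y (*-pos 0<x 0<z) (sym xz≈y)) (log-* x z 0<x 0<z)))
      (solve 2 (λ a b → (a :+ b) :- a := b) refl _ _)

  -- Exchanging x and y in the upper bound gives log z ≥ 1 - 1 / z at z = y / x, multiplied by y.
  log-lower : ∀ {x y} (0<x : 0# < x) (0<y : 0# < y) → y - x ≤ y * (log y 0<y - log x 0<x)
  log-lower {x} {y} 0<x 0<y = ≤-resp
    (solve 2 (λ x y → :- (x :- y) := y :- x) refl x y)
    (solve 3 (λ y a b → :- (y :* (a :- b)) := y :* (b :- a)) refl y _ _)
    (-‿mono-≤ (log-upper 0<y 0<x))

-- Addresses in the binary tree and their breadth-first numbering

-- A word is the address of a vertex of the infinite binary tree, with the
-- last turn first, so that the ancestors of a vertex are its suffixes.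

Word : Set
Word = List Bool

data Position (v w : Word) : Set where
  above : ∀ xs → w ≡ xs ++ v → Position v w
  below : ∀ xs b → v ≡ xs ++ b ∷ w → Position v w
  left  : ∀ xs ys u → v ≡ xs ++ false ∷ u → w ≡ ys ++ true ∷ u → Position v w
  right : ∀ xs ys u → v ≡ xs ++ true ∷ u → w ≡ ys ++ false ∷ u → Position v w

position : ∀ v w → Position v w
position [] w = above w (≡.sym (++-identityʳ w))
position (b ∷ v) w with position v w
... | below xs b′ ≡.refl = below (b ∷ xs) b′ ≡.refl
... | left  xs ys u ≡.refl w≡ = left  (b ∷ xs) ys u ≡.refl w≡
... | right xs ys u ≡.refl w≡ = right (b ∷ xs) ys u ≡.refl w≡
-- The turn taken at v on the way to w is the last entry of `xs`; it has to be compared with b.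
... | above xs ≡.refl with initLast xs
...   | [] = below [] b ≡.refl
...   | ys ∷ʳ′ b′ = turn b b′ (∷ʳ-++ ys b′ v)
  where
  turn : ∀ b b′ → (ys ∷ʳ b′) ++ v ≡ ys ++ b′ ∷ v → Position (b ∷ v) ((ys ∷ʳ b′) ++ v)
  turn false false eq = above ys eq
  turn true  true  eq = above ys eq
  turn false true  eq = left  [] ys v ≡.refl eq
  turn true  false eq = right [] ys v ≡.refl eq

-- The numbering of a binary heap: the children of k are 2 k + 1 and 2 k + 2. A word is thus a
-- bijective binary numeral, least significant digit first, and `successor` is its increment.
index : Word → ℕ
index []          = 0
index (false ∷ w) = 1 ℕ.+ (index w ℕ.+ index w)
index (true  ∷ w) = 2 ℕ.+ (index w ℕ.+ index w)

successor : Word → Word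
successor []          = false ∷ []
successor (false ∷ w) = true ∷ w
successor (true  ∷ w) = false ∷ successor w

word : ℕ → Word
word ℕ.zero    = []
word (ℕ.suc k) = successor (word k)

index-successor : ∀ w → index (successor w) ≡ ℕ.suc (index w)
index-successor []          = ≡.refl
index-successor (false ∷ w) = ≡.refl
index-successor (true  ∷ w) = ≡.trans
  (≡.cong (λ k → 1 ℕ.+ (k ℕ.+ k)) (index-successor w))
  (≡.cong (2 ℕ.+_) (ℕ.+-suc (index w) (index w)))

index-word : ∀ k → index (word k) ≡ k
index-word ℕ.zero    = ≡.refl
index-word (ℕ.suc k) = ≡.trans (index-successor (word k)) (≡.cong ℕ.suc (index-word k))

word-odd : ∀ k → word (1 ℕ.+ (k ℕ.+ k)) ≡ false ∷ word k
word-odd ℕ.zero    = ≡.refl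
word-odd (ℕ.suc k) = ≡.trans
  (≡.cong (λ n → successor (successor (word n))) (ℕ.+-suc k k))
  (≡.cong (λ w → successor (successor w)) (word-odd k))

word-index : ∀ w → word (index w) ≡ w
word-index []          = ≡.refl
word-index (false ∷ w) = ≡.trans (word-odd (index w)) (≡.cong (false ∷_) (word-index w))
word-index (true  ∷ w) = ≡.trans (≡.cong successor (word-odd (index w))) (≡.cong (true ∷_) (word-index w))

index-∷-< : ∀ b w → index w ℕ.< index (b ∷ w)
index-∷-< false w = ℕ.s≤s (ℕ.m≤m+n _ _)
index-∷-< true  w = ℕ.s≤s (ℕ.≤-trans (ℕ.m≤m+n _ _) (ℕ.n≤1+n _))

index-++-≤ : ∀ xs w → index w ℕ.≤ index (xs ++ w)
index-++-≤ []       w = ℕ.≤-refl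
index-++-≤ (b ∷ xs) w = ℕ.≤-trans (index-++-≤ xs w) (ℕ.<⇒≤ (index-∷-< b (xs ++ w)))

-- From a tree of intervals to a Cantor-type set with bounded thickness

module IntervalTrees {c ℓ₁ ℓ₂} (ℝ : RealField c ℓ₁ ℓ₂) where
  open RealField ℝ hiding (zero)
  open OrderedField ℝ
  open Thickness ℝ

  -- The gap ( gl w , gh w ) splits [ lo w , hi w ] into the intervals of
  -- the two children.
  record IntervalTree : Set (c ⊔ ℓ₁ ⊔ ℓ₂) where
    field
      lo gl gh hi : Word → Carrier
      lo<gl    : ∀ w → lo w < gl w
      gl<gh    : ∀ w → gl w < gh w
      gh<hi    : ∀ w → gh w < hi w
      lo-false : ∀ w → lo (false ∷ w) ≈ lo w
      hi-false : ∀ w → hi (false ∷ w) ≈ gl w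
      lo-true  : ∀ w → lo (true ∷ w) ≈ gh w
      hi-true  : ∀ w → hi (true ∷ w) ≈ hi w

    interval : Word → ClosedInterval
    interval w = [ lo w , hi w ]⟨ <⇒≤ (<-trans (lo<gl w) (<-trans (gl<gh w) (gh<hi w))) ⟩

    gap : Word → OpenInterval
    gap w = ⦅ gl w , gh w ⦆⟨ gl<gh w ⟩

    gap⊆interval : ∀ w → ⟪ gap w ⟫ ⊆ ⟦ interval w ⟧
    gap⊆interval w (gl<y , y<gh) =
      <⇒≤ (<-trans (lo<gl w) gl<y) , <⇒≤ (<-trans y<gh (gh<hi w))

    child⊆ : ∀ b w → ⟦ interval (b ∷ w) ⟧ ⊆ ⟦ interval w ⟧
    child⊆ false w (lo≤y , y≤hi) =
      ≤-resp (lo-false w) refl lo≤y ,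
      ≤-trans (≤-resp refl (hi-false w) y≤hi) (<⇒≤ (<-trans (gl<gh w) (gh<hi w)))
    child⊆ true w (lo≤y , y≤hi) =
      ≤-trans (<⇒≤ (<-trans (lo<gl w) (gl<gh w))) (≤-resp (lo-true w) refl lo≤y) ,
      ≤-resp refl (hi-true w) y≤hi

    descendant⊆ : ∀ xs w → ⟦ interval (xs ++ w) ⟧ ⊆ ⟦ interval w ⟧
    descendant⊆ []       w y∈ = y∈
    descendant⊆ (b ∷ xs) w y∈ = descendant⊆ xs w (child⊆ b (xs ++ w) y∈)

    false-child≤gl : ∀ xs w {y} → y ∈ ⟦ interval (xs ++ false ∷ w) ⟧ → y ≤ gl w
    false-child≤gl xs w y∈ = ≤-resp refl (hi-false w) (proj₂ (descendant⊆ xs (false ∷ w) y∈))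

    gh≤true-child : ∀ xs w {y} → y ∈ ⟦ interval (xs ++ true ∷ w) ⟧ → gh w ≤ y
    gh≤true-child xs w y∈ = ≤-resp (lo-true w) refl (proj₁ (descendant⊆ xs (true ∷ w) y∈))

    descendant∌gap : ∀ xs b w {y} → y ∈ ⟦ interval (xs ++ b ∷ w) ⟧ → y ∉ ⟪ gap w ⟫
    descendant∌gap xs false w y∈ (gl<y , _) = false-child≤gl xs w y∈ gl<y
    descendant∌gap xs true  w y∈ (_ , y<gh) = gh≤true-child xs w y∈ y<gh

    -- Since the gap has positive length, y lies above its lower end or below its upper end;
    -- avoiding the gap sharpens either alternative to membership in a child.
    gap-avoided⇒child : ∀ w {y} → y ∈ ⟦ interval w ⟧ → y ∉ ⟪ gap w ⟫ → ∃[ b ] y ∈ ⟦ interval (b ∷ w) ⟧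
    gap-avoided⇒child w {y} (lo≤y , y≤hi) y∉gap = case (<-cotrans (gl<gh w) y)
      where
      case : gl w < y ⊎ y < gh w → ∃[ b ] y ∈ ⟦ interval (b ∷ w) ⟧
      case (inj₁ gl<y) = true ,
        ≤-resp (sym (lo-true w)) refl (λ y<gh → y∉gap (gl<y , y<gh)) , ≤-resp refl (sym (hi-true w)) y≤hi
      case (inj₂ y<gh) = false ,
        ≤-resp (sym (lo-false w)) refl lo≤y , ≤-resp refl (sym (hi-false w)) (λ gl<y → y∉gap (gl<y , y<gh))

    siblings-disjoint : ∀ xs ys w {y} → y ∈ ⟦ interval (xs ++ false ∷ w) ⟧ →
                        y ∉ ⟦ interval (ys ++ true ∷ w) ⟧
    siblings-disjoint xs ys w y∈ y∈′ =
      ≤-trans (gh≤true-child ys w y∈′) (false-child≤gl xs w y∈) (gl<gh w)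

    -- A common point leaves only the position of v at or above w, and indices grow along every
    -- path. Both the disjointness of the gaps and the survival of an interval up to its stage
    -- follow.
    index-mono : ∀ v w {y} → y ∈ ⟦ interval v ⟧ → y ∈ ⟪ gap w ⟫ → index v ℕ.≤ index w
    index-mono v w y∈v y∈w with position v w
    ... | above xs ≡.refl = index-++-≤ xs v
    ... | below xs b ≡.refl = ⊥-elim (descendant∌gap xs b w y∈v y∈w)
    ... | left xs ys u ≡.refl ≡.refl =
      ⊥-elim (siblings-disjoint xs ys u y∈v (gap⊆interval (ys ++ true ∷ u) y∈w))
    ... | right xs ys u ≡.refl ≡.refl =
      ⊥-elim (siblings-disjoint ys xs u (gap⊆interval (ys ++ false ∷ u) y∈w) y∈v)

    gaps : ℕ → OpenInterval
    gaps k = gap (word k)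

    gaps-disjoint : Disjoint gaps
    gaps-disjoint i j i≢j y∈i y∈j = i≢j (ℕ.≤-antisym (ordered i j y∈i y∈j) (ordered j i y∈j y∈i))
      where
      ordered : ∀ i j {y} → y ∈ ⟪ gaps i ⟫ → y ∈ ⟪ gaps j ⟫ → i ℕ.≤ j
      ordered i j y∈i y∈j = ≡.subst₂ ℕ._≤_ (index-word i) (index-word j)
        (index-mono (word i) (word j) (gap⊆interval (word i) y∈i) y∈j)

    interval⊆Stage : ∀ k → ⟦ interval (word k) ⟧ ⊆ Stage (interval []) gaps k
    interval⊆Stage k y∈ =
      ≡.subst (λ w → _ ∈ ⟦ interval w ⟧ → _ ∈ ⟦ interval [] ⟧) (++-identityʳ (word k))
        (descendant⊆ (word k) []) y∈ ,
      λ i i<k y∈i → ℕ.<⇒≱ i<k (≡.subst₂ ℕ._≤_ (index-word k) (index-word i)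
        (index-mono (word k) (word i) y∈ y∈i))

    module _ (w : Word) (J : ClosedInterval)
      (J∌gap : ∀ xs b v → w ≡ xs ++ b ∷ v → ∀ {y} → y ∈ ⟦ J ⟧ → y ∉ ⟪ gap v ⟫)
      (J⊆I : ⟦ J ⟧ ⊆ ⟦ interval [] ⟧) (gap⊆J : ⟪ gap w ⟫ ⊆ ⟦ J ⟧) where

      private
        z = proj₁ (midpoint (gl<gh w))
        z∈gap : z ∈ ⟪ gap w ⟫
        z∈gap = proj₂ (midpoint (gl<gh w))

        squeeze : ∀ {y p} → y ∈ ⟦ J ⟧ → z ≤ p → p ≤ y → p ∈ ⟦ J ⟧
        squeeze (_ , y≤hi) z≤p p≤y =
          ≤-trans (proj₁ (gap⊆J z∈gap)) z≤p , ≤-trans p≤y y≤hi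

        squeeze′ : ∀ {y p} → y ∈ ⟦ J ⟧ → y ≤ p → p ≤ z → p ∈ ⟦ J ⟧
        squeeze′ (lo≤y , _) y≤p p≤z =
          ≤-trans lo≤y y≤p , ≤-trans p≤z (proj₂ (gap⊆J z∈gap))

      -- Induction down the path from the root to w. J is convex and contains z, which lies on one
      -- side of the gap of each proper ancestor; a point of J on the other side would put the
      -- midpoint of that gap into J.
      J⊆ancestor : ∀ xs v → w ≡ xs ++ v → ⟦ J ⟧ ⊆ ⟦ interval v ⟧
      J⊆ancestor xs [] _ y∈ = J⊆I y∈
      J⊆ancestor xs (false ∷ v) ≡.refl {y} y∈ =
        ≤-resp (sym (lo-false v)) refl (proj₁ y∈v) , ≤-resp refl (sym (hi-false v)) y≤gl
        where
        y∈v = J⊆ancestor (xs ∷ʳ false) v (≡.sym (∷ʳ-++ xs false v)) y∈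
        z≤gl : z ≤ gl v
        z≤gl = false-child≤gl xs v (gap⊆interval w z∈gap)
        y≤gl : y ≤ gl v
        y≤gl gl<y = gh≤y y<gh
          where
          gh≤y : gh v ≤ y
          gh≤y y<gh = J∌gap xs false v ≡.refl y∈ (gl<y , y<gh)
          y<gh : y < gh v
          y<gh = let m , gl<m , m<gh = midpoint (gl<gh v) in
            ⊥-elim (J∌gap xs false v ≡.refl
              (squeeze y∈ (≤-trans z≤gl (<⇒≤ gl<m)) (≤-trans (<⇒≤ m<gh) gh≤y)) (gl<m , m<gh))
      J⊆ancestor xs (true ∷ v) ≡.refl {y} y∈ =
        ≤-resp (sym (lo-true v)) refl gh≤y , ≤-resp refl (sym (hi-true v)) (proj₂ y∈v)
        where
        y∈v = J⊆ancestor (xs ∷ʳ true) v (≡.sym (∷ʳ-++ xs true v)) y∈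
        gh≤z : gh v ≤ z
        gh≤z = gh≤true-child xs v (gap⊆interval w z∈gap)
        gh≤y : gh v ≤ y
        gh≤y y<gh = y≤gl gl<y
          where
          y≤gl : y ≤ gl v
          y≤gl gl<y = J∌gap xs true v ≡.refl y∈ (gl<y , y<gh)
          gl<y : gl v < y
          gl<y = let m , gl<m , m<gh = midpoint (gl<gh v) in
            ⊥-elim (J∌gap xs true v ≡.refl
              (squeeze′ y∈ (≤-trans y≤gl (<⇒≤ gl<m)) (≤-trans (<⇒≤ m<gh) gh≤z)) (gl<m , m<gh))

    -- Proper ancestors have smaller indices, so a competing interval inside the stage avoids all
    -- their gaps and is confined to the interval of the vertex.
    interval-largest : ∀ k → IsLargestAround (Stage (interval []) gaps k) (gaps k) (interval (word k))
    interval-largest k = record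
      { inside   = interval⊆Stage k
      ; contains = gap⊆interval (word k)
      ; largest  = λ J J⊆Stage gap⊆J → J⊆ancestor (word k) J
          (λ xs b v w≡ y∈J y∈v → proj₂ (J⊆Stage y∈J) (index v)
            (≡.subst (index v ℕ.<_) (index-word k) (≡.subst (λ u → index v ℕ.< index u) (≡.sym w≡)
              (ℕ.<-≤-trans (index-∷-< b v) (index-++-≤ xs (b ∷ v)))))
            (≡.subst (λ u → _ ∈ ⟪ gap u ⟫) (≡.sym (word-index v)) y∈v))
          (λ y∈J → proj₁ (J⊆Stage y∈J)) gap⊆J [] (word k) ≡.refl
      }

    thicknessAtLeast : ∀ {ℓ τ} {E : Pred Carrier ℓ} →
      (∀ w → τ * (gh w - gl w) ≤ gl w - lo w) →
      (∀ w → τ * (gh w - gl w) ≤ hi w - gh w) →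
      E ⊆ ⟦ interval [] ⟧ →
      (∀ {y} → y ∈ E → ∀ w → y ∉ ⟪ gap w ⟫) →
      (∀ {y} → y ∈ ⟦ interval [] ⟧ → (∀ w → y ∉ ⟪ gap w ⟫) → y ∈ E) →
      ThicknessAtLeast τ E
    thicknessAtLeast boundˡ boundʳ E⊆I E∌gap ⊆E =
      interval [] , gaps ,
      record
        { disjoint   = gaps-disjoint
        ; complement =
            (λ y∈E → E⊆I y∈E , λ k → E∌gap y∈E (word k)) ,
            (λ (y∈I , y∉gaps) → ⊆E y∈I λ w y∈w → y∉gaps (index w)
              (≡.subst (λ u → _ ∈ ⟪ gap u ⟫) (≡.sym (word-index w)) y∈w))
        } ,
      λ k → interval (word k) , interval-largest k , boundˡ (word k) , boundʳ (word k)

-- Values of continued fractions with digits from 1 to 4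

record Digits : Set where
  field
    digit : ℕ → ℕ
    ≥1    : ∀ i → 1 ℕ.≤ digit i
    ≤4    : ∀ i → digit i ℕ.≤ 4

  head : ℕ
  head = digit 0

open Digits

tail : Digits → Digits
tail a = record { digit = digit a ∘ ℕ.suc ; ≥1 = ≥1 a ∘ ℕ.suc ; ≤4 = ≤4 a ∘ ℕ.suc }

module ContinuedFractionValues {c ℓ₁ ℓ₂} (ℝ : RealField c ℓ₁ ℓ₂) where
  open RealField ℝ hiding (zero)
  open OrderedField ℝ
  open ContinuedFractions ℝ

  lim-≤ : ∀ {u l b} → ConvergesTo u l → ∀ k → (∀ n → k ℕ.≤ n → u n ≤ b) → l ≤ b
  lim-≤ {u} {l} {b} u→l k u≤b b<l = let N , near = u→l (l - b) (x<y⇒0<y-x b<l) in u≤b (N ℕ.⊔ k) (ℕ.m≤n⊔m N k)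
    (<-by (x<y⇒0<y-x (proj₁ (near (N ℕ.⊔ k) (ℕ.m≤m⊔n N k))))
      (solve 3 (λ l b u → u :- b := (u :- l) :- :- (l :- b)) refl l b _))

  lim-≥ : ∀ {u l b} → ConvergesTo u l → ∀ k → (∀ n → k ℕ.≤ n → b ≤ u n) → b ≤ l
  lim-≥ {u} {l} {b} u→l k b≤u l<b = let N , near = u→l (b - l) (x<y⇒0<y-x l<b) in b≤u (N ℕ.⊔ k) (ℕ.m≤n⊔m N k)
    (<-by (x<y⇒0<y-x (proj₂ (near (N ℕ.⊔ k) (ℕ.m≤m⊔n N k))))
      (solve 3 (λ l b u → b :- u := (b :- l) :- (u :- l)) refl l b _))

  -- The error bound δ k = 20 / (5 + k) decreases slowly enough for a
  -- contraction by the factor 5/6 to take δ k below δ (k + 1).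

  private
    5+k>0 : ∀ k → 0# < fromℕ (5 ℕ.+ k)
    5+k>0 k = fromℕ-pos (5 ℕ.+ k) (ℕ.s≤s ℕ.z≤n)

  δ : ℕ → Carrier
  δ k = fromℕ 20 * fromℕ (5 ℕ.+ k) ⁻¹[ 5+k>0 k ]

  [5+k]δ≈20 : ∀ k → fromℕ (5 ℕ.+ k) * δ k ≈ fromℕ 20
  [5+k]δ≈20 k = *-⁻¹-cancel (fromℕ (5 ℕ.+ k)) (5+k>0 k) (fromℕ 20)

  δ-pos : ∀ k → 0# < δ k
  δ-pos k = *-pos (fromℕ-pos 20 (ℕ.s≤s ℕ.z≤n)) (⁻¹-pos _ (5+k>0 k))

  -- 4 is the length of the range from 1 to 5 that contains all convergents; this starts the
  -- inductions on the error bound.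
  δ₀≈4 : δ 0 ≈ fromℕ 4
  δ₀≈4 = *-cancelˡ-≈ (fromℕ 5) (5+k>0 0) (trans ([5+k]δ≈20 0) (fromℕ-* 5 4))

  δ<ε : ∀ {k ε} (0<ε : 0# < ε) → fromℕ 20 * ε ⁻¹[ 0<ε ] < fromℕ k → δ k < ε
  δ<ε {k} {ε} 0<ε 20/ε<k = *-cancelˡ-< N (5+k>0 k)
    (<-resp (sym ([5+k]δ≈20 k)) refl (<-≤-trans 20<εk εk≤Nε))
    where
    N = fromℕ (5 ℕ.+ k)
    20<εk : fromℕ 20 < ε * fromℕ k
    20<εk = <-resp (*-⁻¹-cancel ε 0<ε (fromℕ 20)) refl (*-monoˡ-< ε 0<ε 20/ε<k)
    εk≤Nε : ε * fromℕ k ≤ N * ε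
    εk≤Nε = ≤-resp refl (*-comm ε N) (*-monoˡ-≤ ε (<⇒≤ 0<ε) (fromℕ-mono-≤ (ℕ.m≤n+m k 5)))

  δ-small : ∀ ε → 0# < ε → ∃[ k ] δ k < ε
  δ-small ε 0<ε = let k , 20/ε<k = archimedean (fromℕ 20 * ε ⁻¹[ 0<ε ]) in k , δ<ε {k} 0<ε 20/ε<k

  ≤-by-δ : ∀ {x y} → (∀ k → x ≤ y + δ k) → x ≤ y
  ≤-by-δ {x} {y} x≤y+δ y<x = let k , δ<x-y = δ-small (x - y) (x<y⇒0<y-x y<x) in x≤y+δ k (<-by (x<y⇒0<y-x δ<x-y)
    (solve 3 (λ x y d → x :- (y :+ d) := (x :- y) :- d) refl x y (δ k)))

  -- y = d + 1 / x
  record Step (d : ℕ) (x y : Carrier) : Set ℓ₁ where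
    constructor step
    field equation : y * x ≈ fromℕ d * x + fromℕ 1

  record InRange (x : Carrier) : Set ℓ₂ where
    constructor _,_
    field
      1≤ : fromℕ 1 ≤ x
      ≤5 : x ≤ fromℕ 5

    0< : 0# < x
    0< = <-≤-trans (fromℕ-pos 1 (ℕ.s≤s ℕ.z≤n)) 1≤
  open InRange public

  ⁻¹-step : ∀ d x (0<x : 0# < x) → Step d x (fromℕ d + x ⁻¹[ 0<x ])
  ⁻¹-step d x 0<x = step (trans (distribʳ x _ _)
    (+-congˡ (trans (*-comm _ x) (trans (*-inverseʳ x 0<x) (sym fromℕ-1)))))

  step-unique : ∀ {d x x′ y y′} → 0# < x → x ≈ x′ → Step d x y → Step d x′ y′ → y ≈ y′
  step-unique {d} {x} {x′} {y} {y′} 0<x x≈x′ (step eq) (step eq′) = *-cancelˡ-≈ x 0<x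
    (trans (*-comm x y) (trans eq (trans (+-congʳ (*-congˡ x≈x′))
      (trans (sym eq′) (trans (*-congˡ (sym x≈x′)) (*-comm y′ x))))))

  -- The identity 1 / x - 1 / x′ = (x′ - x) / (x x′) without division; it gives both the
  -- antitonicity of a step and its contraction.
  step-difference : ∀ {d x x′ y y′} → Step d x y → Step d x′ y′ →
                    (x * x′) * y - (x * x′) * y′ ≈ x′ - x
  step-difference {d} {x} {x′} {y} {y′} (step eq) (step eq′) = trans
    (solve 4 (λ x x′ y y′ → (x :* x′) :* y :- (x :* x′) :* y′ := x′ :* (y :* x) :- x :* (y′ :* x′)) refl x x′ y y′)
    (trans (+-cong (*-congˡ eq) (-‿cong (*-congˡ eq′)))
      (solve 3 (λ x x′ d → x′ :* (d :* x :+ con (+ 1)) :- x :* (d :* x′ :+ con (+ 1)) := x′ :- x) refl x x′ (fromℕ d)))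

  step-anti-≤ : ∀ {d x x′ y y′} → 0# < x → 0# < x′ → x ≤ x′ → Step d x y → Step d x′ y′ → y′ ≤ y
  step-anti-≤ {x = x} {x′} 0<x 0<x′ x≤x′ st st′ = *-cancelˡ-≤ (x * x′) (*-pos 0<x 0<x′)
    (≤-by (x≤y⇒0≤y-x x≤x′) (step-difference st st′))

  step-anti-< : ∀ {d x x′ y y′} → 0# < x → 0# < x′ → x < x′ → Step d x y → Step d x′ y′ → y′ < y
  step-anti-< {x = x} {x′} 0<x 0<x′ x<x′ st st′ = *-cancelˡ-< (x * x′) (*-pos 0<x 0<x′)
    (<-by (x<y⇒0<y-x x<x′) (step-difference st st′))

  step-lower : ∀ {d x y} → 0# < x → Step d x y → fromℕ d < y
  step-lower {d} {x} {y} 0<x (step eq) = *-cancelˡ-< x 0<x (<-by (fromℕ-pos 1 (ℕ.s≤s ℕ.z≤n))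
    (trans (+-congʳ (trans (*-comm x y) eq))
      (solve 2 (λ d x → (d :* x :+ con (+ 1)) :- x :* d := con (+ 1)) refl (fromℕ d) x)))

  step-upper : ∀ {d x y} → fromℕ 1 ≤ x → Step d x y → y ≤ fromℕ (ℕ.suc d)
  step-upper {d} {x} {y} 1≤x (step eq) = *-cancelˡ-≤ x (<-≤-trans (fromℕ-pos 1 (ℕ.s≤s ℕ.z≤n)) 1≤x)
    (≤-by (x≤y⇒0≤y-x 1≤x) (trans (+-cong (*-congˡ (+-congʳ (sym fromℕ-1))) (-‿cong (trans (*-comm x y) eq)))
      (solve 2 (λ d x → x :* (con (+ 1) :+ d) :- (d :* x :+ con (+ 1)) := x :- con (+ 1)) refl (fromℕ d) x)))

  step-upper-< : ∀ {d x y} → fromℕ 1 < x → Step d x y → y < fromℕ (ℕ.suc d)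
  step-upper-< {d} {x} {y} 1<x (step eq) = *-cancelˡ-< x (<-trans (fromℕ-pos 1 (ℕ.s≤s ℕ.z≤n)) 1<x)
    (<-by (x<y⇒0<y-x 1<x) (trans (+-cong (*-congˡ (+-congʳ (sym fromℕ-1))) (-‿cong (trans (*-comm x y) eq)))
      (solve 2 (λ d x → x :* (con (+ 1) :+ d) :- (d :* x :+ con (+ 1)) := x :- con (+ 1)) refl (fromℕ d) x)))

  step-inRange : ∀ {d x y} → 1 ℕ.≤ d → d ℕ.≤ 4 → InRange x → Step d x y → InRange y
  step-inRange 1≤d d≤4 x∈ eq =
    ≤-trans (fromℕ-mono-≤ 1≤d) (<⇒≤ (step-lower (0< x∈) eq)) ,
    ≤-trans (step-upper (1≤ x∈) eq) (fromℕ-mono-≤ (ℕ.s≤s d≤4))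

  -- From x ≤ 5 one gets d + 1 / x ≥ 6 / 5. This is the origin of the contraction factor 5/6.
  step-6≤5y : ∀ {d x y} → 1 ℕ.≤ d → InRange x → Step d x y → fromℕ 6 ≤ fromℕ 5 * y
  step-6≤5y {d} {x} {y} 1≤d x∈ (step eq) = *-cancelˡ-≤ x (0< x∈)
    (≤-by (+-nonneg (x≤y⇒0≤y-x (≤5 x∈)) (*-nonneg (fromℕ-nonneg 5)
        (*-nonneg (<⇒≤ (0< x∈)) (x≤y⇒0≤y-x (fromℕ-mono-≤ 1≤d)))))
      (trans (+-congʳ (trans (solve 2 (λ x y → x :* (con (+ 5) :* y) := con (+ 5) :* (y :* x)) refl x y) (*-congˡ eq)))
        (solve 2 (λ d x → con (+ 5) :* (d :* x :+ con (+ 1)) :- x :* con (+ 6)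
          := (con (+ 5) :- x) :+ con (+ 5) :* (x :* (d :- con (+ 1)))) refl (fromℕ d) x)))

  -- The difference is divided by x x′ ≥ 6 / 5, for which it is enough that one of the two factors
  -- is at least 6 / 5. A step reverses the order, so the roles of the two sides are exchanged
  -- between hypothesis and conclusion.
  contraction : ∀ {d x x′ y y′} k → fromℕ 1 ≤ x → fromℕ 6 ≤ fromℕ 5 * x′ →
    Step d x y → Step d x′ y′ → x′ ≤ x + δ k → y ≤ y′ + δ (ℕ.suc k)
  contraction {d} {x} {x′} {y} {y′} k 1≤x 6≤5x′ st st′ x′≤x+δ y′+δ<y =
    6Nw≤100 (<-≤-trans 100<5[1+N]w 5[1+N]w≤6Nw)
    where
    N  = fromℕ (5 ℕ.+ k)
    w  = y - y′
    5ᴿ = fromℕ 5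
    20ᴿ = fromℕ 20
    0≤N : 0# ≤ N
    0≤N = fromℕ-nonneg (5 ℕ.+ k)
    δ<w : δ (ℕ.suc k) < w
    δ<w = <-by (x<y⇒0<y-x y′+δ<y)
      (solve 3 (λ y y′ d → (y :- y′) :- d := y :- (y′ :+ d)) refl y y′ (δ (ℕ.suc k)))
    0≤w : 0# ≤ w
    0≤w = <⇒≤ (<-trans (δ-pos (ℕ.suc k)) δ<w)
    100<5[1+N]w : 5ᴿ * 20ᴿ < 5ᴿ * ((1# + N) * w)
    100<5[1+N]w = *-monoˡ-< 5ᴿ (5+k>0 0)
      (<-resp ([5+k]δ≈20 (ℕ.suc k)) refl (*-monoˡ-< (1# + N) (5+k>0 (ℕ.suc k)) δ<w))
    wxx′≈x′-x : w * (x * x′) ≈ x′ - x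
    wxx′≈x′-x = trans
      (solve 3 (λ p y y′ → (y :- y′) :* p := p :* y :- p :* y′) refl (x * x′) y y′)
      (step-difference st st′)
    6≤5xx′ : fromℕ 6 ≤ 5ᴿ * (x * x′)
    6≤5xx′ = ≤-trans 6≤5x′ (≤-by
      (*-nonneg (≤-trans (fromℕ-nonneg 6) 6≤5x′) (x≤y⇒0≤y-x 1≤x))
      (solve 2 (λ x x′ → con (+ 5) :* (x :* x′) :- con (+ 5) :* x′ := (con (+ 5) :* x′) :* (x :- con (+ 1))) refl x x′))
    N[x′-x]≤20 : N * (x′ - x) ≤ 20ᴿ
    N[x′-x]≤20 = ≤-resp refl ([5+k]δ≈20 k) (*-monoˡ-≤ N 0≤N (≤-by (x≤y⇒0≤y-x x′≤x+δ)
      (solve 3 (λ x x′ d → d :- (x′ :- x) := (x :+ d) :- x′) refl x x′ (δ k))))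
    6Nw≤100 : (N * w) * fromℕ 6 ≤ 5ᴿ * 20ᴿ
    6Nw≤100 = ≤-trans (*-monoˡ-≤ (N * w) (*-nonneg 0≤N 0≤w) 6≤5xx′)
      (≤-resp (sym (trans (solve 3 (λ n w p → (n :* w) :* (con (+ 5) :* p) := con (+ 5) :* (n :* (w :* p))) refl N w (x * x′))
                 (*-congˡ (*-congˡ wxx′≈x′-x)))) refl
        (*-monoˡ-≤ 5ᴿ (fromℕ-nonneg 5) N[x′-x]≤20))
    -- 5 (1 + N) ≤ 6 N amounts to 5 ≤ N: this is why the denominators of δ start at 5.
    5[1+N]w≤6Nw : 5ᴿ * ((1# + N) * w) ≤ (N * w) * fromℕ 6
    5[1+N]w≤6Nw = ≤-by (*-nonneg (x≤y⇒0≤y-x (fromℕ-mono-≤ (ℕ.m≤m+n 5 k))) 0≤w)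
      (trans (+-congˡ (-‿cong (*-congˡ (*-congʳ (+-congʳ (sym fromℕ-1))))))
        (solve 2 (λ n w → (n :* w) :* con (+ 6) :- con (+ 5) :* ((con (+ 1) :+ n) :* w) := (n :- con (+ 5)) :* w) refl N w))

  convergent : Digits → ℕ → Carrier
  convergent a = finiteCF (digit a) (≥1 a)

  convergent-step : ∀ a n → Step (head a) (convergent (tail a) n) (convergent a (ℕ.suc n))
  convergent-step a n = ⁻¹-step (head a) _ _

  convergent-inRange : ∀ a n → InRange (convergent a n)
  convergent-inRange a ℕ.zero    =
    fromℕ-mono-≤ (≥1 a 0) , fromℕ-mono-≤ (ℕ.≤-trans (≤4 a 0) (ℕ.n≤1+n 4))
  convergent-inRange a (ℕ.suc n) =
    step-inRange (≥1 a 0) (≤4 a 0) (convergent-inRange (tail a) n) (convergent-step a n)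

  convergent-6≤5x : ∀ a n → fromℕ 6 ≤ fromℕ 5 * convergent a (ℕ.suc n)
  convergent-6≤5x a n = step-6≤5y (≥1 a 0) (convergent-inRange (tail a) n) (convergent-step a n)

  inRange-close : ∀ {x y} → InRange x → InRange y → x ≤ y + δ 0
  inRange-close {x} {y} x∈ y∈ = ≤-trans (≤5 x∈) (≤-resp refl (+-congˡ (sym δ₀≈4))
    (≤-resp (sym (fromℕ-+ 1 4)) refl (+-monoˡ-≤ (fromℕ 4) (1≤ y∈))))

  -- m and n change places in the recursive call because a step reverses the order. The offset
  -- `ℕ.suc k` ensures that each contraction meets a convergent of index at least 1, hence at least
  -- 6 / 5.
  convergents-close : ∀ k a m n → convergent a (ℕ.suc k ℕ.+ m) ≤ convergent a (ℕ.suc k ℕ.+ n) + δ k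
  convergents-close ℕ.zero    a m n = inRange-close (convergent-inRange a (1 ℕ.+ m)) (convergent-inRange a (1 ℕ.+ n))
  convergents-close (ℕ.suc k) a m n = contraction k
    (1≤ (convergent-inRange (tail a) (ℕ.suc k ℕ.+ m))) (convergent-6≤5x (tail a) (k ℕ.+ n))
    (convergent-step a (ℕ.suc k ℕ.+ m)) (convergent-step a (ℕ.suc k ℕ.+ n)) (convergents-close k (tail a) n m)

  convergent-cauchy : ∀ a → Cauchy (convergent a)
  convergent-cauchy a ε 0<ε = let k , δ<ε = δ-small ε 0<ε in ℕ.suc k , λ m n k<m k<n →
    <-by (x<y⇒0<y-x (close k δ<ε n m k<n k<m))
      (solve 3 (λ x y e → (x :- y) :- :- e := (x :+ e) :- y) refl (convergent a m) (convergent a n) ε) ,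
    <-by (x<y⇒0<y-x (close k δ<ε m n k<m k<n))
      (solve 3 (λ x y e → e :- (x :- y) := (y :+ e) :- x) refl (convergent a m) (convergent a n) ε)
    where
    close : ∀ k → δ k < ε → ∀ m n → k ℕ.< m → k ℕ.< n → convergent a m < convergent a n + ε
    close k δ<ε m n k<m k<n = ≤-<-trans
      (≡.subst₂ (λ m n → convergent a m ≤ convergent a n + δ k)
        (ℕ.m+[n∸m]≡n k<m) (ℕ.m+[n∸m]≡n k<n)
        (convergents-close k a (m ℕ.∸ ℕ.suc k) (n ℕ.∸ ℕ.suc k)))
      (<-resp (+-comm _ _) (+-comm _ _) (+-monoˡ-< (convergent a n) δ<ε))

  abstract
    value : Digits → Carrier
    value a = proj₁ (complete (convergent a) (convergent-cauchy a))

    value-expansion : ∀ a → IsCFExpansionOf (digit a) (≥1 a) (value a)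
    value-expansion a = proj₂ (complete (convergent a) (convergent-cauchy a))

  lim-unique : ∀ {u l l′} → ConvergesTo u l → ConvergesTo u l′ → l ≈ l′
  lim-unique u→l u→l′ = ≤-antisym (lim-mono u→l u→l′) (lim-mono u→l′ u→l)
    where
    lim-mono : ∀ {u l l′} → ConvergesTo u l → ConvergesTo u l′ → l ≤ l′
    lim-mono {u} {l} {l′} u→l u→l′ l′<l =
      let m , l′<m , m<l = midpoint l′<l
          N , near = u→l′ (m - l′) (x<y⇒0<y-x l′<m)
      in lim-≤ u→l N (λ n N≤n → <⇒≤ (<-by (x<y⇒0<y-x (proj₂ (near n N≤n)))
           (solve 3 (λ m l u → m :- u := (m :- l) :- (u :- l)) refl m l′ (u n)))) m<l

  value-inRange : ∀ a → InRange (value a)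
  value-inRange a =
    lim-≥ (value-expansion a) 0 (λ n _ → 1≤ (convergent-inRange a n)) ,
    lim-≤ (value-expansion a) 0 (λ n _ → ≤5 (convergent-inRange a n))

  value-pos : ∀ a → 0# < value a
  value-pos a = 0< (value-inRange a)

  private
    shift : ∀ {k} {P : ℕ → Set ℓ₂} → (∀ m → P (k ℕ.+ m)) → ∀ n → k ℕ.≤ n → P n
    shift {k} {P} p n k≤n = ≡.subst P (ℕ.m+[n∸m]≡n k≤n) (p (n ℕ.∸ k))

  value-6≤5x : ∀ a → fromℕ 6 ≤ fromℕ 5 * value a
  value-6≤5x a = ≤-resp (*-⁻¹-cancel 5ᴿ 0<5 (fromℕ 6)) refl (*-monoˡ-≤ 5ᴿ (<⇒≤ 0<5)
    -- The bound starts at index 1, because the convergent of index 0 is a bare digit and may be 1.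
    (lim-≥ {b = b} (value-expansion a) 1 (shift {P = λ n → b ≤ convergent a n} λ n →
      *-cancelˡ-≤ 5ᴿ 0<5 (≤-resp (sym (*-⁻¹-cancel 5ᴿ 0<5 (fromℕ 6))) refl (convergent-6≤5x a n)))))
    where
    5ᴿ = fromℕ 5
    0<5 = fromℕ-pos 5 (ℕ.s≤s ℕ.z≤n)
    b = fromℕ 6 * 5ᴿ ⁻¹[ 0<5 ]

  value≤convergent : ∀ k a n → value a ≤ convergent a (ℕ.suc k ℕ.+ n) + δ k
  value≤convergent k a n = lim-≤ (value-expansion a) (ℕ.suc k)
    (shift {P = λ m → convergent a m ≤ convergent a (ℕ.suc k ℕ.+ n) + δ k} λ m → convergents-close k a m n)

  x≤y+z⇒x-z≤y : ∀ {x y z} → x ≤ y + z → x - z ≤ y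
  x≤y+z⇒x-z≤y {x} {y} {z} x≤y+z = ≤-by (x≤y⇒0≤y-x x≤y+z)
    (solve 3 (λ x y z → y :- (x :- z) := (y :+ z) :- x) refl x y z)

  x-z≤y⇒x≤y+z : ∀ {x y z} → x - z ≤ y → x ≤ y + z
  x-z≤y⇒x≤y+z {x} {y} {z} x-z≤y = ≤-by (x≤y⇒0≤y-x x-z≤y)
    (solve 3 (λ x y z → (y :+ z) :- x := y :- (x :- z)) refl x y z)

  convergent≤value : ∀ k a n → convergent a (ℕ.suc k ℕ.+ n) ≤ value a + δ k
  convergent≤value k a n = x-z≤y⇒x≤y+z (lim-≥ (value-expansion a) (ℕ.suc k)
    (shift {P = λ m → convergent a (ℕ.suc k ℕ.+ n) - δ k ≤ convergent a m}
      λ m → x≤y+z⇒x-z≤y (convergents-close k a n m)))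

  -- No continuity of the reciprocal is needed: the contraction shows that the convergents of a also
  -- approach d + 1 / t, with t the value of the tail, so the two limits agree.
  value-step : ∀ a → Step (head a) (value (tail a)) (value a)
  value-step a = step (trans (*-congʳ v≈w) (Step.equation w-step))
    where
    w = fromℕ (head a) + value (tail a) ⁻¹[ value-pos (tail a) ]
    w-step : Step (head a) (value (tail a)) w
    w-step = ⁻¹-step (head a) (value (tail a)) (value-pos (tail a))
    w≤ : ∀ k n → w ≤ convergent a (2 ℕ.+ k ℕ.+ n) + δ (ℕ.suc k)
    w≤ k n = contraction k (1≤ (value-inRange (tail a))) (convergent-6≤5x (tail a) (k ℕ.+ n))
      w-step (convergent-step a (ℕ.suc k ℕ.+ n)) (convergent≤value k (tail a) n)
    ≤w : ∀ k n → convergent a (2 ℕ.+ k ℕ.+ n) ≤ w + δ (ℕ.suc k)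
    ≤w k n = contraction k (1≤ (convergent-inRange (tail a) (ℕ.suc k ℕ.+ n))) (value-6≤5x (tail a))
      (convergent-step a (ℕ.suc k ℕ.+ n)) w-step (value≤convergent k (tail a) n)
    δ-anti : ∀ k → δ (ℕ.suc k) ≤ δ k
    δ-anti k = *-cancelˡ-≤ N 0<N (≤-resp refl (sym ([5+k]δ≈20 k))
      (≤-resp refl ([5+k]δ≈20 (ℕ.suc k)) (*-monoʳ-≤ (δ (ℕ.suc k)) (<⇒≤ (δ-pos (ℕ.suc k)))
        (fromℕ-mono-≤ (ℕ.n≤1+n (5 ℕ.+ k))))))
      where
      N = fromℕ (5 ℕ.+ k)
      0<N = fromℕ-pos (5 ℕ.+ k) (ℕ.s≤s ℕ.z≤n)
    v≈w : value a ≈ w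
    v≈w = ≤-antisym
      (≤-by-δ λ k → ≤-trans
        (lim-≤ (value-expansion a) (2 ℕ.+ k) (shift {P = λ n → convergent a n ≤ w + δ (ℕ.suc k)} (≤w k)))
        (+-monoʳ-≤ w (δ-anti k)))
      (≤-by-δ λ k → ≤-trans
        (x-z≤y⇒x≤y+z (lim-≥ (value-expansion a) (2 ℕ.+ k)
          (shift {P = λ n → w - δ (ℕ.suc k) ≤ convergent a n} λ n → x≤y+z⇒x-z≤y (w≤ k n))))
        (+-monoʳ-≤ (value a) (δ-anti k)))

  1<value : ∀ a → fromℕ 1 < value a
  1<value a = *-cancelˡ-< (fromℕ 5) (fromℕ-pos 5 (ℕ.s≤s ℕ.z≤n))
    (<-≤-trans (<-by (fromℕ-pos 1 (ℕ.s≤s ℕ.z≤n)) (solve 0 (con (+ 6) :- con (+ 5) :* con (+ 1) := con (+ 1)) refl))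
      (value-6≤5x a))

  -- If n x were an integer, so would be n / (tail of x), whose
  -- denominator in lowest terms is smaller.
  value-irrational : ∀ a → Irrational (value a)
  value-irrational a m n = descent (ℕ.suc n) n ℕ.≤-refl a m
    where
    descent : ∀ N n → n ℕ.< N → ∀ a m → ¬ (fromℕ (ℕ.suc n) * value a ≈ fromℤ m)
    descent (ℕ.suc N) n (ℕ.s≤s n≤N) a m qx≈m = absurd k kt≈q
      where
      q = fromℕ (ℕ.suc n)
      t = value (tail a)
      k = m ℤ.- (+ ℕ.suc n) ℤ.* (+ head a)
      0<q = fromℕ-pos (ℕ.suc n) (ℕ.s≤s ℕ.z≤n)

      k≈m-qd : fromℤ k ≈ fromℤ m - q * fromℕ (head a)
      k≈m-qd = trans (fromℤ-+ m (ℤ.- ((+ ℕ.suc n) ℤ.* (+ head a))))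
        (+-congˡ (trans (fromℤ-neg ((+ ℕ.suc n) ℤ.* (+ head a))) (-‿cong (fromℤ-* (+ ℕ.suc n) (+ head a)))))

      kt≈q : fromℤ k * t ≈ q
      kt≈q = trans (*-congʳ (trans k≈m-qd (+-congʳ (sym qx≈m))))
        (trans (solve 4 (λ q x d t → (q :* x :- q :* d) :* t := q :* (x :* t) :- q :* (d :* t)) refl q (value a) (fromℕ (head a)) t)
          (trans (+-congʳ (*-congˡ (Step.equation (value-step a))))
            (solve 3 (λ q d t → q :* (d :* t :+ con (+ 1)) :- q :* (d :* t) := q) refl q (fromℕ (head a)) t)))

      absurd : ∀ k → fromℤ k * t ≈ q → ⊥
      absurd (+ ℕ.zero) eq = <-irrefl (<-resp refl (trans (sym eq) (zeroˡ t)) 0<q)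
      absurd -[1+ k ] eq = <-irrefl (<-resp eq refl (<-trans
        (<-by (*-pos (fromℕ-pos (ℕ.suc k) (ℕ.s≤s ℕ.z≤n)) (value-pos (tail a)))
          (solve 2 (λ k t → con (+ 0) :- :- k :* t := k :* t) refl (fromℕ (ℕ.suc k)) t)) 0<q))
      absurd (+ ℕ.suc k) eq = descent N k (ℕ.<-≤-trans k<n n≤N) (tail a) (+ ℕ.suc n) eq
        where
        k<n : k ℕ.< n
        k<n = ℕ.≤-pred (fromℕ-cancel-< (<-resp (trans (*-congˡ fromℕ-1) (*-identityʳ _)) eq
          (*-monoˡ-< (fromℕ (ℕ.suc k)) (fromℕ-pos (ℕ.suc k) (ℕ.s≤s ℕ.z≤n)) (1<value (tail a)))))

-- The automaton of admissible digit sequences and its extreme sequences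

-- The states of the automaton accepting the digit sequences of F₄* are
-- the suffixes of the input which restrict its continuation.

data State : Set where
  free after4 after41 after414 after4141 : State

-- Both forbidden words end in 4, so in every state the allowed digits are exactly 1, ..., `top s`,
-- and admissibility is a bound on each digit.
top : State → ℕ
top free      = 4
top after4    = 3
top after41   = 4
top after414  = 3
top after4141 = 3

-- One suffix is enough memory: what 414 forbids includes what its ending 4 forbids, and likewise
-- for 4141 and its ending 41.
move : State → ℕ → State
move free     4 = after4
move after4   1 = after41
move after41  4 = after414
move after414 1 = after4141
move _        _ = free

run : State → (ℕ → ℕ) → ℕ → State
run s a ℕ.zero    = s
run s a (ℕ.suc n) = run (move s (a 0)) (a ∘ ℕ.suc) n

Admissible : State → (ℕ → ℕ) → Set
Admissible s a = ∀ n → a n ℕ.≤ top (run s a n)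

admissible-∷ : ∀ {s a} → a 0 ℕ.≤ top s → Admissible (move s (a 0)) (a ∘ ℕ.suc) → Admissible s a
admissible-∷ a₀≤ adm ℕ.zero    = a₀≤
admissible-∷ a₀≤ adm (ℕ.suc n) = adm n

admissible-no-44 : ∀ s a → Admissible s a → ∀ i → ¬ (a i ≡ 4 × a (1 ℕ.+ i) ≡ 4)
admissible-no-44 s a adm (ℕ.suc i) eqs =
  admissible-no-44 (move s (a 0)) (a ∘ ℕ.suc) (adm ∘ ℕ.suc) i eqs
admissible-no-44 s a adm ℕ.zero (a₀≡4 , a₁≡4) = bad s
  (≡.subst (ℕ._≤ top s) a₀≡4 (adm 0))
  (≡.subst₂ (λ d e → e ℕ.≤ top (move s d)) a₀≡4 a₁≡4 (adm 1))
  where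
  bad : ∀ s → 4 ℕ.≤ top s → ¬ (4 ℕ.≤ top (move s 4))
  bad free      _ (ℕ.s≤s (ℕ.s≤s (ℕ.s≤s ())))
  bad after4    (ℕ.s≤s (ℕ.s≤s (ℕ.s≤s ())))
  bad after41   _ (ℕ.s≤s (ℕ.s≤s (ℕ.s≤s ())))
  bad after414  (ℕ.s≤s (ℕ.s≤s (ℕ.s≤s ())))
  bad after4141 (ℕ.s≤s (ℕ.s≤s (ℕ.s≤s ())))

Is41414 : (ℕ → ℕ) → ℕ → Set
Is41414 a i = a i ≡ 4 × a (1 ℕ.+ i) ≡ 1 × a (2 ℕ.+ i) ≡ 4 × a (3 ℕ.+ i) ≡ 1 × a (4 ℕ.+ i) ≡ 4

admissible-no-41414 : ∀ s a → Admissible s a → ∀ i → ¬ Is41414 a i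
admissible-no-41414 s a adm (ℕ.suc i) eqs =
  admissible-no-41414 (move s (a 0)) (a ∘ ℕ.suc) (adm ∘ ℕ.suc) i eqs
admissible-no-41414 s a adm ℕ.zero (a₀≡4 , a₁≡1 , a₂≡4 , a₃≡1 , a₄≡4) = bad s
  (≡.subst (ℕ._≤ top s) a₀≡4 (adm 0))
  (≡.subst₂ (λ t e → e ℕ.≤ top t) state₂ a₂≡4 (adm 2))
  (≡.subst₂ (λ t e → e ℕ.≤ top t)
     (≡.trans (≡.cong₂ (λ t d → move (move t d) (a 3)) state₂ a₂≡4)
       (≡.cong (move (move (move (move s 4) 1) 4)) a₃≡1)) a₄≡4 (adm 4))
  where
  state₂ : move (move s (a 0)) (a 1) ≡ move (move s 4) 1
  state₂ = ≡.cong₂ (λ d e → move (move s d) e) a₀≡4 a₁≡1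
  bad : ∀ s → 4 ℕ.≤ top s → 4 ℕ.≤ top (move (move s 4) 1) →
        ¬ (4 ℕ.≤ top (move (move (move (move s 4) 1) 4) 1))
  bad free      _ _ (ℕ.s≤s (ℕ.s≤s (ℕ.s≤s ())))
  bad after4    (ℕ.s≤s (ℕ.s≤s (ℕ.s≤s ())))
  bad after41   _ (ℕ.s≤s (ℕ.s≤s (ℕ.s≤s ())))
  bad after414  (ℕ.s≤s (ℕ.s≤s (ℕ.s≤s ())))
  bad after4141 (ℕ.s≤s (ℕ.s≤s (ℕ.s≤s ())))

-- What the remembered suffix forbids to a continuation.
Compatible : State → (ℕ → ℕ) → Set
Compatible free      a = ⊤
Compatible after4    a = ¬ a 0 ≡ 4 × ¬ (a 0 ≡ 1 × a 1 ≡ 4 × a 2 ≡ 1 × a 3 ≡ 4)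
Compatible after41   a = ¬ (a 0 ≡ 4 × a 1 ≡ 1 × a 2 ≡ 4)
Compatible after414  a = ¬ a 0 ≡ 4 × ¬ (a 0 ≡ 1 × a 1 ≡ 4)
Compatible after4141 a = ¬ a 0 ≡ 4

module _ {a : ℕ → ℕ} (a≤4 : ∀ i → a i ℕ.≤ 4)
         (no-44 : ∀ i → ¬ (a i ≡ 4 × a (1 ℕ.+ i) ≡ 4)) (no-41414 : ∀ i → ¬ Is41414 a i) where

  private
    ≤3 : a 0 ℕ.≤ 4 → ¬ a 0 ≡ 4 → a 0 ℕ.≤ 3
    ≤3 a₀≤4 a₀≢4 = ℕ.≤-pred (ℕ.≤∧≢⇒< a₀≤4 a₀≢4)

  compatible-top : ∀ s → Compatible s a → a 0 ℕ.≤ top s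
  compatible-top free      _        = a≤4 0
  compatible-top after4    (≢4 , _) = ≤3 (a≤4 0) ≢4
  compatible-top after41   _        = a≤4 0
  compatible-top after414  (≢4 , _) = ≤3 (a≤4 0) ≢4
  compatible-top after4141 ≢4       = ≤3 (a≤4 0) ≢4

  compatible-move : ∀ s → Compatible s a → Compatible (move s (a 0)) (a ∘ ℕ.suc)
  compatible-move free _ with a 0 in eq
  ... | 0 = tt
  ... | 1 = tt
  ... | 2 = tt
  ... | 3 = tt
  ... | 4 = (λ a₁≡4 → no-44 0 (eq , a₁≡4)) , (λ p → no-41414 0 (eq , p))
  ... | ℕ.suc (ℕ.suc (ℕ.suc (ℕ.suc (ℕ.suc _)))) = tt
  compatible-move after4 (_ , ≢1414) with a 0 in eq
  ... | 0 = tt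
  ... | 1 = λ p → ≢1414 (≡.refl , p)
  ... | ℕ.suc (ℕ.suc _) = tt
  compatible-move after41 ≢414 with a 0 in eq
  ... | 0 = tt
  ... | 1 = tt
  ... | 2 = tt
  ... | 3 = tt
  ... | 4 = (λ a₁≡4 → no-44 0 (eq , a₁≡4)) , (λ p → ≢414 (≡.refl , p))
  ... | ℕ.suc (ℕ.suc (ℕ.suc (ℕ.suc (ℕ.suc _)))) = tt
  compatible-move after414 (_ , ≢14) with a 0 in eq
  ... | 0 = tt
  ... | 1 = λ a₁≡4 → ≢14 (≡.refl , a₁≡4)
  ... | ℕ.suc (ℕ.suc _) = tt
  compatible-move after4141 _ = tt

compatible⇒admissible : ∀ s (a : ℕ → ℕ) → (∀ i → a i ℕ.≤ 4) →
  (∀ i → ¬ (a i ≡ 4 × a (1 ℕ.+ i) ≡ 4)) → (∀ i → ¬ Is41414 a i) →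
  Compatible s a → Admissible s a
compatible⇒admissible s a a≤4 no-44 no-41414 comp ℕ.zero =
  compatible-top a≤4 no-44 no-41414 s comp
compatible⇒admissible s a a≤4 no-44 no-41414 comp (ℕ.suc n) =
  compatible⇒admissible (move s (a 0)) (a ∘ ℕ.suc) (a≤4 ∘ ℕ.suc) (no-44 ∘ ℕ.suc) (no-41414 ∘ ℕ.suc)
    (compatible-move a≤4 no-44 no-41414 s comp) n

mutual
  -- The map t ↦ d + 1 / t is decreasing, so a least sequence takes the digit 1 and continues with a
  -- greatest one, and conversely.
  leastDigits : State → ℕ → ℕ
  leastDigits s ℕ.zero    = 1
  leastDigits s (ℕ.suc n) = greatestDigits (move s 1) n

  greatestDigits : State → ℕ → ℕ
  greatestDigits s ℕ.zero    = top s
  greatestDigits s (ℕ.suc n) = leastDigits (move s (top s)) n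

2≤top : ∀ s → 2 ℕ.≤ top s
2≤top free      = ℕ.s≤s (ℕ.s≤s ℕ.z≤n)
2≤top after4    = ℕ.s≤s (ℕ.s≤s ℕ.z≤n)
2≤top after41   = ℕ.s≤s (ℕ.s≤s ℕ.z≤n)
2≤top after414  = ℕ.s≤s (ℕ.s≤s ℕ.z≤n)
2≤top after4141 = ℕ.s≤s (ℕ.s≤s ℕ.z≤n)

1≤top : ∀ s → 1 ℕ.≤ top s
1≤top s = ℕ.<⇒≤ (2≤top s)

top≤4 : ∀ s → top s ℕ.≤ 4
top≤4 free      = ℕ.≤-refl
top≤4 after4    = ℕ.n≤1+n 3
top≤4 after41   = ℕ.≤-refl
top≤4 after414  = ℕ.n≤1+n 3
top≤4 after4141 = ℕ.n≤1+n 3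

mutual
  least≥1 : ∀ s n → 1 ℕ.≤ leastDigits s n
  least≥1 s ℕ.zero    = ℕ.≤-refl
  least≥1 s (ℕ.suc n) = greatest≥1 (move s 1) n

  greatest≥1 : ∀ s n → 1 ℕ.≤ greatestDigits s n
  greatest≥1 s ℕ.zero    = 1≤top s
  greatest≥1 s (ℕ.suc n) = least≥1 (move s (top s)) n

mutual
  least≤4 : ∀ s n → leastDigits s n ℕ.≤ 4
  least≤4 s ℕ.zero    = ℕ.s≤s ℕ.z≤n
  least≤4 s (ℕ.suc n) = greatest≤4 (move s 1) n

  greatest≤4 : ∀ s n → greatestDigits s n ℕ.≤ 4
  greatest≤4 s ℕ.zero    = top≤4 s
  greatest≤4 s (ℕ.suc n) = least≤4 (move s (top s)) n

least : State → Digits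
least s = record { digit = leastDigits s ; ≥1 = least≥1 s ; ≤4 = least≤4 s }

greatest : State → Digits
greatest s = record { digit = greatestDigits s ; ≥1 = greatest≥1 s ; ≤4 = greatest≤4 s }

-- Numerical bounds in integer arithmetic

-- Rational bounds, as integer multiples of 1 / K, for the extreme values
-- of the continued fractions admissible from each state.

record Bounds : Set where
  field
    least↓ least↑ greatest↓ greatest↑ : State → ℕ

module _ (K : ℕ) where

  -- If K x ≤ h then K (d + 1 / x) ≥ d K + K² / h. Dividing by `ℕ.suc h` avoids a zero divisor and
  -- errs in the safe direction.
  stepFloor : ℕ → ℕ → ℕ
  stepFloor d h = d ℕ.* K ℕ.+ K ℕ.* K / ℕ.suc h

  -- `ℕ.suc (ℕ.pred l)` is l except at l = 0, where it is 1; the outer successor rounds the quotient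
  -- up.
  stepCeiling : ℕ → ℕ → ℕ
  stepCeiling d l = d ℕ.* K ℕ.+ ℕ.suc (K ℕ.* K / ℕ.suc (ℕ.pred l))

  refine : Bounds → Bounds
  refine B = record
    { least↓    = λ s → stepFloor   1      (greatest↑ (move s 1))
    ; least↑    = λ s → stepCeiling 1       (greatest↓ (move s 1))
    ; greatest↓ = λ s → stepFloor   (top s) (least↑ (move s (top s)))
    ; greatest↑ = λ s → stepCeiling (top s) (least↓ (move s (top s)))
    }
    where open Bounds B

  bounds : ℕ → Bounds
  bounds ℕ.zero    = record
    { least↓    = λ _ → K
    ; least↑    = λ _ → 5 ℕ.* K
    ; greatest↓ = λ _ → K
    ; greatest↑ = λ _ → 5 ℕ.* K
    }
  bounds (ℕ.suc n) = refine (bounds n)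

-- The weight w of a state is chosen such that 5 q′ ≥ w q for consecutive
-- numerators, or denominators, q′ , q of the convergents leading to it.
weight : State → ℕ
weight after41 = 4
weight _       = 0

module _ (T S K : ℕ) (B : Bounds) where
  open Bounds B

  start↑ end↓ end↑ : State → ℕ → ℕ
  start↑ s d = stepCeiling K d (greatest↓ (move s d))
  end↓   s d = stepFloor   K d (least↑ (move s d))
  end↑   s d = stepCeiling K d (least↓ (move s d))

  -- With gap ( a , b ) and neighbouring bridges [ c , a ] and [ b , h ], these are T (b - a) ≤ S (a
  -- - c) and T (b - a)(5 h + w) ≤ S (h - b)(5 a + w). Subtracted terms are moved across, so that
  -- every occurrence can be rounded in its own safe direction; w carries a factor K because the
  -- second inequality is scaled by K².
  BridgeCheckˡ BridgeCheckʳ : State → ℕ → Set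
  BridgeCheckˡ s d =
    T ℕ.* start↑ s (ℕ.suc d) ℕ.+ S ℕ.* start↑ s d ℕ.≤ (T ℕ.+ S) ℕ.* end↓ s d
  BridgeCheckʳ s d =
    T ℕ.* start↑ s (ℕ.suc d) ℕ.* (5 ℕ.* greatest↑ s ℕ.+ weight s ℕ.* K) ℕ.+
    S ℕ.* start↑ s (ℕ.suc d) ℕ.* (5 ℕ.* end↑ s d ℕ.+ weight s ℕ.* K) ℕ.≤
    T ℕ.* end↓ s d ℕ.* (5 ℕ.* greatest↓ s ℕ.+ weight s ℕ.* K) ℕ.+
    S ℕ.* greatest↓ s ℕ.* (5 ℕ.* end↓ s d ℕ.+ weight s ℕ.* K)

  -- With d = `ℕ.suc e`, the range of e is 1 ≤ d < `top s`, one case for each gap between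
  -- consecutive allowed digits.
  BridgeChecks : Set
  BridgeChecks = ∀ s {e} → e ℕ.< ℕ.pred (top s) → BridgeCheckˡ s (ℕ.suc e) × BridgeCheckʳ s (ℕ.suc e)

  bridgeChecks? : ∀ s → Dec (∀ {e} → e ℕ.< ℕ.pred (top s) → BridgeCheckˡ s (ℕ.suc e) × BridgeCheckʳ s (ℕ.suc e))
  bridgeChecks? s = ℕ.allUpTo? (λ e → (_ ℕ.≤? _) ×-dec (_ ℕ.≤? _)) (ℕ.pred (top s))

-- T / S is the thickness 101 / 100; the bounds have five decimals and come from eight refinements
-- of the range from 1 to 5.
bridgeChecks : BridgeChecks 101 100 100000 (bounds 100000 8)
bridgeChecks free      = toWitness {a? = bridgeChecks? 101 100 100000 (bounds 100000 8) free} tt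
bridgeChecks after4    = toWitness {a? = bridgeChecks? 101 100 100000 (bounds 100000 8) after4} tt
bridgeChecks after41   = toWitness {a? = bridgeChecks? 101 100 100000 (bounds 100000 8) after41} tt
bridgeChecks after414  = toWitness {a? = bridgeChecks? 101 100 100000 (bounds 100000 8) after414} tt
bridgeChecks after4141 = toWitness {a? = bridgeChecks? 101 100 100000 (bounds 100000 8) after4141} tt

-- Extreme values, and soundness of the numerical bounds

module ExtremeValues {c ℓ₁ ℓ₂} (ℝ : RealField c ℓ₁ ℓ₂) where
  open RealField ℝ hiding (zero)
  open OrderedField ℝ
  open ContinuedFractionValues ℝ
  open Digits

  low high : State → Carrier
  low  s = value (least s)
  high s = value (greatest s)

  low-step : ∀ s → Step 1 (high (move s 1)) (low s)
  low-step s = value-step (least s)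

  high-step : ∀ s → Step (top s) (low (move s (top s))) (high s)
  high-step s = value-step (greatest s)

  -- Different leading digits already decide the order, by the integer parts. Equal ones pass the
  -- comparison, reversed, to the tails, and the contraction improves the error from δ k to δ (k +
  -- 1).
  admissible-near : ∀ k s a → Admissible s (digit a) →
                    low s ≤ value a + δ k × value a ≤ high s + δ k
  admissible-near ℕ.zero s a adm =
    inRange-close (value-inRange (least s)) (value-inRange a) ,
    inRange-close (value-inRange a) (value-inRange (greatest s))
  admissible-near (ℕ.suc k) s a adm =
    lower (ℕ.m≤n⇒m<n∨m≡n (≥1 a 0)) , upper (ℕ.m≤n⇒m<n∨m≡n (adm 0))
    where
    ≤+δ : ∀ {x y} → x ≤ y → x ≤ y + δ (ℕ.suc k)
    ≤+δ {x} {y} x≤y = ≤-trans x≤y (<⇒≤ (<-by (δ-pos (ℕ.suc k))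
      (solve 2 (λ y d → (y :+ d) :- y := d) refl y (δ (ℕ.suc k)))))

    separated : ∀ {d e x x′ y y′} → InRange x → 0# < x′ → d ℕ.< e → Step d x y → Step e x′ y′ → y ≤ y′
    separated x∈ 0<x′ d<e st st′ =
      ≤-trans (step-upper (1≤ x∈) st) (≤-trans (fromℕ-mono-≤ d<e) (<⇒≤ (step-lower 0<x′ st′)))

    lower : 1 ℕ.< digit a 0 ⊎ 1 ≡ digit a 0 → low s ≤ value a + δ (ℕ.suc k)
    lower (inj₁ 1<a₀) = ≤+δ (separated (value-inRange (tail (least s))) (value-pos (tail a)) 1<a₀
      (low-step s) (value-step a))
    lower (inj₂ 1≡a₀) = contraction k (1≤ (value-inRange (tail (least s)))) (value-6≤5x (tail a))
      (low-step s) (≡.subst (λ d → Step d (value (tail a)) (value a)) (≡.sym 1≡a₀) (value-step a))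
      (proj₂ (admissible-near k (move s 1) (tail a)
        (≡.subst (λ d → Admissible (move s d) (digit (tail a))) (≡.sym 1≡a₀) (adm ∘ ℕ.suc))))

    upper : digit a 0 ℕ.< top s ⊎ digit a 0 ≡ top s → value a ≤ high s + δ (ℕ.suc k)
    upper (inj₁ a₀<t) = ≤+δ (separated (value-inRange (tail a)) (value-pos (tail (greatest s))) a₀<t
      (value-step a) (high-step s))
    upper (inj₂ a₀≡t) = contraction k (1≤ (value-inRange (tail a))) (value-6≤5x (tail (greatest s)))
      (≡.subst (λ d → Step d (value (tail a)) (value a)) a₀≡t (value-step a)) (high-step s)
      (proj₁ (admissible-near k (move s (top s)) (tail a)
        (≡.subst (λ d → Admissible (move s d) (digit (tail a))) a₀≡t (adm ∘ ℕ.suc))))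

  admissible≤high : ∀ {s} a → Admissible s (digit a) → value a ≤ high s
  admissible≤high a adm = ≤-by-δ λ k → proj₂ (admissible-near k _ a adm)

  -- The numbers [ d ; a₁ , … ] with digits admissible from s lie
  -- between start s d and end s d.
  start end : State → ℕ → Carrier
  start s d = fromℕ d + high (move s d) ⁻¹[ value-pos (greatest (move s d)) ]
  end   s d = fromℕ d + low (move s d) ⁻¹[ value-pos (least (move s d)) ]

  start-step : ∀ s d → Step d (high (move s d)) (start s d)
  start-step s d = ⁻¹-step d _ _

  end-step : ∀ s d → Step d (low (move s d)) (end s d)
  end-step s d = ⁻¹-step d _ _

  low≈start : ∀ s → low s ≈ start s 1
  low≈start s = step-unique (value-pos (greatest (move s 1))) refl (low-step s) (start-step s 1)

  high≈end : ∀ s → high s ≈ end s (top s)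
  high≈end s = step-unique (value-pos (least (move s (top s)))) refl (high-step s) (end-step s (top s))

  start-pos : ∀ s d → 0# < start s d
  start-pos s d = +-nonneg-pos (fromℕ-nonneg d) (⁻¹-pos _ (value-pos (greatest (move s d))))

  end-pos : ∀ s d → 0# < end s d
  end-pos s d = +-nonneg-pos (fromℕ-nonneg d) (⁻¹-pos _ (value-pos (least (move s d))))

  end<start : ∀ s {d e} → d ℕ.< e → end s d < start s e
  end<start s {d} {e} d<e = ≤-<-trans (step-upper (1≤ (value-inRange (least (move s d)))) (end-step s d))
    (≤-<-trans (fromℕ-mono-≤ d<e) (step-lower (value-pos (greatest (move s e))) (start-step s e)))

  low<high : ∀ s → low s < high s
  low<high s = <-trans (step-upper-< (1<value (greatest (move s 1))) (low-step s))
    (≤-<-trans (fromℕ-mono-≤ (2≤top s)) (step-lower (value-pos (least (move s (top s)))) (high-step s)))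

  start<end : ∀ s d → start s d < end s d
  start<end s d = step-anti-< (value-pos (least (move s d))) (value-pos (greatest (move s d)))
    (low<high (move s d)) (end-step s d) (start-step s d)

  end≤high : ∀ s {d} → d ℕ.≤ top s → end s d ≤ high s
  end≤high s {d} d≤t = case (ℕ.m≤n⇒m<n∨m≡n d≤t)
    where
    case : d ℕ.< top s ⊎ d ≡ top s → end s d ≤ high s
    case (inj₁ d<t) = <⇒≤ (<-≤-trans (<-trans (end<start s d<t) (start<end s (top s)))
      (≤-reflexive (sym (high≈end s))))
    case (inj₂ ≡.refl) = ≤-reflexive (sym (high≈end s))

  start≤admissible : ∀ {s d} a → Admissible s (digit a) → d ℕ.≤ head a → start s d ≤ value a
  start≤admissible {s} {d} a adm d≤a₀ = case (ℕ.m≤n⇒m<n∨m≡n d≤a₀)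
    where
    case : d ℕ.< head a ⊎ d ≡ head a → start s d ≤ value a
    case (inj₁ d<a₀) = ≤-trans (step-upper (1≤ (value-inRange (greatest (move s d)))) (start-step s d))
      (≤-trans (fromℕ-mono-≤ d<a₀) (<⇒≤ (step-lower (value-pos (tail a)) (value-step a))))
    case (inj₂ ≡.refl) = step-anti-≤ (value-pos (tail a)) (value-pos (greatest (move s d)))
      (admissible≤high (tail a) (adm ∘ ℕ.suc)) (value-step a) (start-step s d)

  record Between (K l h : ℕ) (x : Carrier) : Set ℓ₂ where
    constructor _,_
    field
      lower : fromℕ l ≤ fromℕ K * x
      upper : fromℕ K * x ≤ fromℕ h
  open Between

  stepFloor-sound : ∀ {K d h x y} → 1 ℕ.≤ K → 0# < x → Step d x y →
                fromℕ K * x ≤ fromℕ h → fromℕ (stepFloor K d h) ≤ fromℕ K * y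
  stepFloor-sound {K} {d} {h} {x} {y} 1≤K 0<x (step eq) Kx≤h = ≤-resp
    (sym (trans (fromℕ-+ (d ℕ.* K) q) (+-congʳ (fromℕ-* d K)))) refl
    (*-cancelˡ-≤ x 0<x (≤-by (x≤y⇒0≤y-x xq≤k) (trans
      (+-congʳ (trans (solve 3 (λ x k y → x :* (k :* y) := k :* (y :* x)) refl x k y) (*-congˡ eq)))
      (solve 4 (λ x k d q → k :* (d :* x :+ con (+ 1)) :- x :* (d :* k :+ q) := k :- x :* q) refl x k (fromℕ d) (fromℕ q)))))
    where
    k = fromℕ K
    q = K ℕ.* K / ℕ.suc h
    qh≤KK : q ℕ.* h ℕ.≤ K ℕ.* K
    qh≤KK = ℕ.≤-trans (ℕ.*-monoʳ-≤ q (ℕ.n≤1+n h)) (m/n*n≤m (K ℕ.* K) (ℕ.suc h))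
    xq≤k : x * fromℕ q ≤ k
    xq≤k = *-cancelˡ-≤ k (fromℕ-pos K 1≤K) (≤-resp
      (solve 3 (λ k x q → q :* (k :* x) := k :* (x :* q)) refl k x (fromℕ q)) (fromℕ-* K K)
      (≤-trans (*-monoˡ-≤ (fromℕ q) (fromℕ-nonneg q) Kx≤h)
        (≤-resp (fromℕ-* q h) refl (fromℕ-mono-≤ qh≤KK))))

  stepCeiling-sound : ∀ {K d l x y} → 1 ℕ.≤ K → InRange x → Step d x y →
                fromℕ l ≤ fromℕ K * x → fromℕ K * y ≤ fromℕ (stepCeiling K d l)
  stepCeiling-sound {K} {d} {l} {x} {y} 1≤K x∈ (step eq) l≤Kx = ≤-resp
    refl (sym (trans (fromℕ-+ (d ℕ.* K) q) (+-congʳ (fromℕ-* d K))))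
    (*-cancelˡ-≤ x (0< x∈) (≤-by (x≤y⇒0≤y-x k≤xq) (trans
      (+-congˡ (-‿cong (trans (solve 3 (λ x k y → x :* (k :* y) := k :* (y :* x)) refl x k y) (*-congˡ eq))))
      (solve 4 (λ x k d q → x :* (d :* k :+ q) :- k :* (d :* x :+ con (+ 1)) := x :* q :- k) refl x k (fromℕ d) (fromℕ q)))))
    where
    k = fromℕ K
    l′ = ℕ.suc (ℕ.pred l)
    q = ℕ.suc (K ℕ.* K / l′)
    KK≤ql′ : K ℕ.* K ℕ.≤ q ℕ.* l′
    KK≤ql′ = ℕ.≤-trans (ℕ.≤-reflexive (m≡m%n+[m/n]*n (K ℕ.* K) l′))
      (ℕ.+-monoˡ-≤ _ (ℕ.<⇒≤ (m%n<n (K ℕ.* K) l′)))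
    l′≤Kx : ∀ l → fromℕ l ≤ k * x → fromℕ (ℕ.suc (ℕ.pred l)) ≤ k * x
    l′≤Kx (ℕ.suc l) l≤Kx = l≤Kx
    -- For l = 0 the hypothesis says nothing; the divisor is then 1, and 1 ≤ K x since K and x are
    -- at least 1.
    l′≤Kx ℕ.zero    _    = ≤-resp (sym (fromℕ-* 1 1)) refl
      (*-mono-≤ (fromℕ-nonneg 1) (<⇒≤ (0< x∈)) (fromℕ-mono-≤ 1≤K) (1≤ x∈))
    k≤xq : k ≤ x * fromℕ q
    k≤xq = *-cancelˡ-≤ k (fromℕ-pos K 1≤K) (≤-resp (fromℕ-* K K)
      (solve 3 (λ k x q → q :* (k :* x) := k :* (x :* q)) refl k x (fromℕ q))
      (≤-trans (fromℕ-mono-≤ KK≤ql′) (≤-resp (sym (fromℕ-* q l′)) refl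
        (*-monoˡ-≤ (fromℕ q) (fromℕ-nonneg q) (l′≤Kx l l≤Kx)))))

  record Sound (K : ℕ) (B : Bounds) : Set ℓ₂ where
    constructor _,_
    open Bounds B
    field
      least∈    : ∀ s → Between K (least↓ s) (least↑ s) (low s)
      greatest∈ : ∀ s → Between K (greatest↓ s) (greatest↑ s) (high s)

  bounds-sound : ∀ {K} → 1 ℕ.≤ K → ∀ n → Sound K (bounds K n)
  bounds-sound {K} 1≤K ℕ.zero = (λ s → initial (least s)) , (λ s → initial (greatest s))
    where
    initial : ∀ a → Between K K (5 ℕ.* K) (value a)
    initial a =
      ≤-resp (trans (*-congˡ fromℕ-1) (*-identityʳ _)) refl
        (*-monoˡ-≤ (fromℕ K) (fromℕ-nonneg K) (1≤ (value-inRange a))) ,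
      ≤-resp refl (trans (*-comm _ _) (sym (fromℕ-* 5 K)))
        (*-monoˡ-≤ (fromℕ K) (fromℕ-nonneg K) (≤5 (value-inRange a)))
  bounds-sound {K} 1≤K (ℕ.suc n) =
    (λ s → let a = greatest (move s 1); s∈ = greatest∈ (move s 1) in
      stepFloor-sound {h = greatest↑ (move s 1)} 1≤K (value-pos a) (low-step s) (upper s∈) ,
      stepCeiling-sound {l = greatest↓ (move s 1)} 1≤K (value-inRange a) (low-step s) (lower s∈)) ,
    (λ s → let a = least (move s (top s)); s∈ = least∈ (move s (top s)) in
      stepFloor-sound {h = least↑ (move s (top s))} 1≤K (value-pos a) (high-step s) (upper s∈) ,
      stepCeiling-sound {l = least↓ (move s (top s))} 1≤K (value-inRange a) (high-step s) (lower s∈))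
    where
    open Bounds (bounds K n)
    open Sound (bounds-sound 1≤K n)

  module _ {T S K : ℕ} {B : Bounds} (1≤K : 1 ℕ.≤ K) (sound : Sound K B) where
    open Bounds B
    open Sound sound

    start≤ : ∀ s d → fromℕ K * start s d ≤ fromℕ (start↑ T S K B s d)
    start≤ s d = stepCeiling-sound {l = greatest↓ (move s d)} 1≤K (value-inRange (greatest (move s d)))
      (start-step s d) (lower (greatest∈ (move s d)))

    end≥ : ∀ s d → fromℕ (end↓ T S K B s d) ≤ fromℕ K * end s d
    end≥ s d = stepFloor-sound {h = least↑ (move s d)} 1≤K (value-pos (least (move s d)))
      (end-step s d) (upper (least∈ (move s d)))

    end≤ : ∀ s d → fromℕ K * end s d ≤ fromℕ (end↑ T S K B s d)
    end≤ s d = stepCeiling-sound {l = least↓ (move s d)} 1≤K (value-inRange (least (move s d)))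
      (end-step s d) (lower (least∈ (move s d)))

    private
      k = fromℕ K
      0<k : 0# < k
      0<k = fromℕ-pos K 1≤K

      ↑-+ : ∀ {x y} m n → x ≤ fromℕ m → y ≤ fromℕ n → x + y ≤ fromℕ (m ℕ.+ n)
      ↑-+ m n x≤m y≤n = ≤-resp refl (sym (fromℕ-+ m n)) (+-mono-≤ x≤m y≤n)

      ↓-+ : ∀ {x y} m n → fromℕ m ≤ x → fromℕ n ≤ y → fromℕ (m ℕ.+ n) ≤ x + y
      ↓-+ m n m≤x n≤y = ≤-resp (sym (fromℕ-+ m n)) refl (+-mono-≤ m≤x n≤y)

      ↑-* : ∀ {x y} m n → 0# ≤ x → x ≤ fromℕ m → y ≤ fromℕ n → x * y ≤ fromℕ (m ℕ.* n)
      ↑-* m n 0≤x x≤m y≤n = ≤-resp refl (sym (fromℕ-* m n)) (*-mono-≤ 0≤x (fromℕ-nonneg n) x≤m y≤n)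

      ↓-* : ∀ {x y} m n → fromℕ m ≤ x → fromℕ n ≤ y → fromℕ (m ℕ.* n) ≤ x * y
      ↓-* m n m≤x n≤y = ≤-resp (sym (fromℕ-* m n)) refl
        (*-mono-≤ (fromℕ-nonneg m) (≤-trans (fromℕ-nonneg n) n≤y) m≤x n≤y)

      ↑-scale : ∀ {x} m n → x ≤ fromℕ n → fromℕ m * x ≤ fromℕ (m ℕ.* n)
      ↑-scale m n = ↑-* m n (fromℕ-nonneg m) ≤-refl

      ↓-scale : ∀ {x} m n → fromℕ n ≤ x → fromℕ (m ℕ.* n) ≤ fromℕ m * x
      ↓-scale m n = ↓-* m n ≤-refl

      ≤-fromℕ : ∀ {x y} m n → x ≤ fromℕ m → m ℕ.≤ n → fromℕ n ≤ y → x ≤ y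
      ≤-fromℕ m n x≤m m≤n n≤y = ≤-trans x≤m (≤-trans (fromℕ-mono-≤ m≤n) n≤y)

    bridgeˡ-scaled : ∀ {a b c₀ A↓ B↑ C↑} → fromℕ A↓ ≤ k * a → k * b ≤ fromℕ B↑ → k * c₀ ≤ fromℕ C↑ →
      T ℕ.* B↑ ℕ.+ S ℕ.* C↑ ℕ.≤ (T ℕ.+ S) ℕ.* A↓ → fromℕ T * (b - a) ≤ fromℕ S * (a - c₀)
    bridgeˡ-scaled {a} {b} {c₀} {A↓} {B↑} {C↑} A≤ ≤B ≤C check = *-cancelˡ-≤ k 0<k (≤-by (x≤y⇒0≤y-x sum≤)
      (trans (solve 6 (λ k t u a b c → k :* (u :* (a :- c)) :- k :* (t :* (b :- a))
                := (t :+ u) :* (k :* a) :- (t :* (k :* b) :+ u :* (k :* c))) refl k (fromℕ T) (fromℕ S) a b c₀)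
        (+-congʳ (*-congʳ (sym (fromℕ-+ T S))))))
      where
      sum≤ : fromℕ T * (k * b) + fromℕ S * (k * c₀) ≤ fromℕ (T ℕ.+ S) * (k * a)
      sum≤ = ≤-fromℕ (T ℕ.* B↑ ℕ.+ S ℕ.* C↑) ((T ℕ.+ S) ℕ.* A↓)
        (↑-+ (T ℕ.* B↑) (S ℕ.* C↑) (↑-scale T B↑ ≤B) (↑-scale S C↑ ≤C))
        check (↓-scale (T ℕ.+ S) A↓ A≤)

    bridgeʳ-scaled : ∀ {a b h f w A↓ A↑ B↑ H↓ H↑} → fromℕ A↓ ≤ k * a → k * a ≤ fromℕ A↑ →
      0# ≤ b → k * b ≤ fromℕ B↑ → fromℕ H↓ ≤ k * h → k * h ≤ fromℕ H↑ →
      T ℕ.* B↑ ℕ.* (f ℕ.* H↑ ℕ.+ w ℕ.* K) ℕ.+ S ℕ.* B↑ ℕ.* (f ℕ.* A↑ ℕ.+ w ℕ.* K) ℕ.≤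
      T ℕ.* A↓ ℕ.* (f ℕ.* H↓ ℕ.+ w ℕ.* K) ℕ.+ S ℕ.* H↓ ℕ.* (f ℕ.* A↓ ℕ.+ w ℕ.* K) →
      fromℕ T * (b - a) * (fromℕ f * h + fromℕ w) ≤ fromℕ S * (h - b) * (fromℕ f * a + fromℕ w)
    bridgeʳ-scaled {a} {b} {h} {f} {w} {A↓} {A↑} {B↑} {H↓} {H↑} A≤ ≤A 0≤b ≤B H≤ ≤H check =
      *-cancelˡ-≤ (k * k) (*-pos 0<k 0<k) (≤-by (x≤y⇒0≤y-x sum≤)
        (trans (+-cong (scale (fromℕ S) h b A′) (-‿cong (scale (fromℕ T) b a H′)))
          (solve 4 (λ x y z v → (x :- y) :- (z :- v) := (v :+ x) :- (z :+ y)) refl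
            (fromℕ S * (k * h) * (k * A′)) (fromℕ S * (k * b) * (k * A′))
            (fromℕ T * (k * b) * (k * H′)) (fromℕ T * (k * a) * (k * H′)))))
      where
      A′ H′ : Carrier
      A′ = fromℕ f * a + fromℕ w
      H′ = fromℕ f * h + fromℕ w
      W = w ℕ.* K

      scale : ∀ u p q g → (k * k) * (u * (p - q) * g) ≈ u * (k * p) * (k * g) - u * (k * q) * (k * g)
      scale u p q g = solve 5 (λ k u p q g →
        (k :* k) :* (u :* (p :- q) :* g) := u :* (k :* p) :* (k :* g) :- u :* (k :* q) :* (k :* g)) refl k u p q g

      distribute : ∀ x → fromℕ f * (k * x) + fromℕ W ≈ k * (fromℕ f * x + fromℕ w)
      distribute x = trans (+-congˡ (fromℕ-* w K))
        (solve 4 (λ f k x w → f :* (k :* x) :+ w :* k := k :* (f :* x :+ w)) refl (fromℕ f) k x (fromℕ w))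

      linear↑ : ∀ x n → k * x ≤ fromℕ n → k * (fromℕ f * x + fromℕ w) ≤ fromℕ (f ℕ.* n ℕ.+ W)
      linear↑ x n x≤n = ≤-resp (distribute x) refl (↑-+ (f ℕ.* n) W (↑-scale f n x≤n) ≤-refl)

      linear↓ : ∀ x n → fromℕ n ≤ k * x → fromℕ (f ℕ.* n ℕ.+ W) ≤ k * (fromℕ f * x + fromℕ w)
      linear↓ x n n≤x = ≤-resp refl (distribute x) (↓-+ (f ℕ.* n) W (↓-scale f n n≤x) ≤-refl)

      0≤kb : ∀ m → 0# ≤ fromℕ m * (k * b)
      0≤kb m = *-nonneg (fromℕ-nonneg m) (*-nonneg (<⇒≤ 0<k) 0≤b)

      sum≤ : fromℕ T * (k * b) * (k * H′) + fromℕ S * (k * b) * (k * A′) ≤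
             fromℕ T * (k * a) * (k * H′) + fromℕ S * (k * h) * (k * A′)
      sum≤ = ≤-fromℕ
        (T ℕ.* B↑ ℕ.* (f ℕ.* H↑ ℕ.+ W) ℕ.+ S ℕ.* B↑ ℕ.* (f ℕ.* A↑ ℕ.+ W))
        (T ℕ.* A↓ ℕ.* (f ℕ.* H↓ ℕ.+ W) ℕ.+ S ℕ.* H↓ ℕ.* (f ℕ.* A↓ ℕ.+ W))
        (↑-+ (T ℕ.* B↑ ℕ.* (f ℕ.* H↑ ℕ.+ W)) (S ℕ.* B↑ ℕ.* (f ℕ.* A↑ ℕ.+ W))
          (↑-* (T ℕ.* B↑) (f ℕ.* H↑ ℕ.+ W) (0≤kb T) (↑-scale T B↑ ≤B) (linear↑ h H↑ ≤H))
          (↑-* (S ℕ.* B↑) (f ℕ.* A↑ ℕ.+ W) (0≤kb S) (↑-scale S B↑ ≤B) (linear↑ a A↑ ≤A)))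
        check
        (↓-+ (T ℕ.* A↓ ℕ.* (f ℕ.* H↓ ℕ.+ W)) (S ℕ.* H↓ ℕ.* (f ℕ.* A↓ ℕ.+ W))
          (↓-* (T ℕ.* A↓) (f ℕ.* H↓ ℕ.+ W) (↓-scale T A↓ A≤) (linear↓ h H↓ H≤))
          (↓-* (S ℕ.* H↓) (f ℕ.* A↓ ℕ.+ W) (↓-scale S H↓ H≤) (linear↓ a A↓ A≤)))

    bridgeˡ : ∀ s d → BridgeCheckˡ T S K B s d →
      fromℕ T * (start s (ℕ.suc d) - end s d) ≤ fromℕ S * (end s d - start s d)
    bridgeˡ s d = bridgeˡ-scaled {end s d} {start s (ℕ.suc d)} {start s d}
      {end↓ T S K B s d} {start↑ T S K B s (ℕ.suc d)} {start↑ T S K B s d} (end≥ s d) (start≤ s (ℕ.suc d)) (start≤ s d)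

    bridgeʳ : ∀ s d → BridgeCheckʳ T S K B s d →
      fromℕ T * (start s (ℕ.suc d) - end s d) * (fromℕ 5 * high s + fromℕ (weight s)) ≤
      fromℕ S * (high s - start s (ℕ.suc d)) * (fromℕ 5 * end s d + fromℕ (weight s))
    bridgeʳ s d = bridgeʳ-scaled {end s d} {start s (ℕ.suc d)} {high s} {5} {weight s}
      {end↓ T S K B s d} {end↑ T S K B s d} {start↑ T S K B s (ℕ.suc d)} {greatest↓ s} {greatest↑ s} (end≥ s d) (end≤ s d)
      (<⇒≤ (start-pos s (ℕ.suc d))) (start≤ s (ℕ.suc d)) (lower (greatest∈ s)) (upper (greatest∈ s))

  -- The gap between the digits d and d + 1, times T / S, is shorter than
  -- its neighbours, also after any Möbius map whose pole is controlled by
  -- the weight.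
  Marginˡ Marginʳ : ℕ → ℕ → Set ℓ₂
  Marginˡ T S = ∀ s d → 1 ℕ.≤ d → d ℕ.< top s →
    fromℕ T * (start s (ℕ.suc d) - end s d) ≤ fromℕ S * (end s d - start s d)
  Marginʳ T S = ∀ s d → 1 ℕ.≤ d → d ℕ.< top s →
    fromℕ T * (start s (ℕ.suc d) - end s d) * (fromℕ 5 * high s + fromℕ (weight s)) ≤
    fromℕ S * (high s - start s (ℕ.suc d)) * (fromℕ 5 * end s d + fromℕ (weight s))

  sound⇒margins : ∀ {T S K B} → 1 ℕ.≤ K → Sound K B → BridgeChecks T S K B → Marginˡ T S × Marginʳ T S
  sound⇒margins {T} {S} {K} {B} 1≤K sound checks =
    (λ { s (ℕ.suc e) _ d<t → bridgeˡ {T} {S} {K} {B} 1≤K sound s (ℕ.suc e) (proj₁ (checks s (ℕ.<⇒≤pred d<t))) }) ,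
    (λ { s (ℕ.suc e) _ d<t → bridgeʳ {T} {S} {K} {B} 1≤K sound s (ℕ.suc e) (proj₂ (checks s (ℕ.<⇒≤pred d<t))) })

  margins : Marginˡ 101 100 × Marginʳ 101 100
  margins = sound⇒margins {101} {100} {100000} {bounds 100000 8} (ℕ.s≤s ℕ.z≤n)
    (bounds-sound {100000} (ℕ.s≤s ℕ.z≤n) 8) bridgeChecks

-- Möbius maps of prefixes and the vertices of the tree

-- A Möbius map t ↦ (u t + u′) / (v t + v′) of determinant 1.  Appending a
-- digit to a continued fraction composes its map with t ↦ d + 1 / t, of
-- determinant −1; to stay with determinant 1 the map is then inverted,
-- and `rising` records whether it stands for itself or for its inverse.
record Matrix : Set where
  field
    rising    : Bool
    u u′ v v′ : ℕ
    1≤u       : 1 ℕ.≤ u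
    1≤u′      : 1 ℕ.≤ u′
    1≤v       : 1 ℕ.≤ v
    1≤v′      : 1 ℕ.≤ v′
    det       : u ℕ.* v′ ≡ 1 ℕ.+ u′ ℕ.* v

append : Matrix → ℕ → Matrix
append M d = record
  { rising = not rising
  ; u  = v ℕ.* d ℕ.+ v′
  ; u′ = v
  ; v  = u ℕ.* d ℕ.+ u′
  ; v′ = u
  ; 1≤u  = ℕ.≤-trans 1≤v′ (ℕ.m≤n+m v′ (v ℕ.* d))
  ; 1≤u′ = 1≤v
  ; 1≤v  = ℕ.≤-trans 1≤u′ (ℕ.m≤n+m u′ (u ℕ.* d))
  ; 1≤v′ = 1≤u
  ; det  = ≡.trans
      (solve 4 (λ u v v′ d → (v :* d :+ v′) :* u := v :* (u :* d) :+ u :* v′) ≡.refl u v v′ d)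
      (≡.trans (≡.cong (v ℕ.* (u ℕ.* d) ℕ.+_) det)
        (solve 4 (λ u u′ v d → v :* (u :* d) :+ (con 1 :+ u′ :* v) := con 1 :+ v :* (u :* d :+ u′)) ≡.refl u u′ v d))
  }
  where
  open Matrix M
  open +-*-Solver

-- The map of [ 4 ; 3 , t ] = (13 t + 4) / (3 t + 1).
rootMatrix : Matrix
rootMatrix = record
  { rising = true
  ; u = 13 ; u′ = 4 ; v = 3 ; v′ = 1
  ; 1≤u = ℕ.s≤s ℕ.z≤n ; 1≤u′ = ℕ.s≤s ℕ.z≤n ; 1≤v = ℕ.s≤s ℕ.z≤n ; 1≤v′ = ℕ.s≤s ℕ.z≤n
  ; det = ≡.refl
  }

-- A digit 4 turns a row (u , u′) into (4 u + u′ , u), whence the condition after 4. A following 1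
-- gives (u + u′ , u), and 4 (u + u′) ≤ 5 u is then 4 u′ ≤ u again.
Row : State → ℕ → ℕ → Set
Row after4  u u′ = 4 ℕ.* u′ ℕ.≤ u
Row after41 u u′ = 4 ℕ.* u ℕ.≤ 5 ℕ.* u′
Row _       u u′ = ⊤

row-weight : ∀ s u u′ → Row s u u′ → weight s ℕ.* u ℕ.≤ 5 ℕ.* u′
row-weight free      u u′ _ = ℕ.z≤n
row-weight after4    u u′ _ = ℕ.z≤n
row-weight after41   u u′ r = r
row-weight after414  u u′ _ = ℕ.z≤n
row-weight after4141 u u′ _ = ℕ.z≤n

row-move : ∀ s d {u u′} → Row s u u′ → Row (move s d) (u ℕ.* d ℕ.+ u′) u
row-move free 0 _ = tt
row-move free 1 _ = tt
row-move free 2 _ = tt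
row-move free 3 _ = tt
row-move free 4 {u} {u′} _ = ℕ.≤-trans (ℕ.≤-reflexive (ℕ.*-comm 4 u)) (ℕ.m≤m+n (u ℕ.* 4) u′)
row-move free (ℕ.suc (ℕ.suc (ℕ.suc (ℕ.suc (ℕ.suc _))))) _ = tt
row-move after4 0 _ = tt
row-move after4 1 {u} {u′} 4u′≤u = ℕ.≤-trans
  (ℕ.≤-reflexive (solve 2 (λ u u′ → con 4 :* (u :* con 1 :+ u′) := con 4 :* u :+ con 4 :* u′) ≡.refl u u′))
  (ℕ.≤-trans (ℕ.+-monoʳ-≤ (4 ℕ.* u) 4u′≤u)
    (ℕ.≤-reflexive (solve 1 (λ u → con 4 :* u :+ u := con 5 :* u) ≡.refl u)))
  where open +-*-Solver
row-move after4 (ℕ.suc (ℕ.suc _)) _ = tt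
row-move after41 0 _ = tt
row-move after41 1 _ = tt
row-move after41 2 _ = tt
row-move after41 3 _ = tt
row-move after41 4 _ = tt
row-move after41 (ℕ.suc (ℕ.suc (ℕ.suc (ℕ.suc (ℕ.suc _))))) _ = tt
row-move after414 0 _ = tt
row-move after414 1 _ = tt
row-move after414 (ℕ.suc (ℕ.suc _)) _ = tt
row-move after4141 _ _ = tt

-- Only the numerator row enters the estimates, but the rows are exchanged at each digit, so the
-- condition has to be carried for both.
Rows : State → Matrix → Set
Rows s M = Row s u u′ × Row s v v′
  where open Matrix M

rows-append : ∀ s d M → Rows s M → Rows (move s d) (append M d)
rows-append s d M (row , row′) = row-move s d row′ , row-move s d row

-- The sequences starting with the digits recorded in `matrix`, followed
-- by a digit ≥ `current`; the gap is the one between current and current + 1.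
record Node : Set where
  field
    matrix      : Matrix
    state       : State
    rows        : Rows state matrix
    current     : ℕ
    1≤current   : 1 ℕ.≤ current
    current<top : current ℕ.< top state

freshNode : ∀ M s → Rows s M → Node
freshNode M s rows = record
  { matrix = M ; state = s ; rows = rows ; current = 1 ; 1≤current = ℕ.≤-refl ; current<top = 2≤top s }

appendNode : ∀ M s → Rows s M → ℕ → Node
appendNode M s rows d = freshNode (append M d) (move s d) (rows-append s d M rows)

-- For d = `top s` a single digit is left and there is no gap between digits; the vertex is then the
-- one that starts splitting the digit after it.
enterBy : ∀ M s → Rows s M → ∀ d → 1 ℕ.≤ d → d ℕ.< top s ⊎ d ≡ top s → Node
enterBy M s rows d 1≤d (inj₁ d<t) = record
  { matrix = M ; state = s ; rows = rows ; current = d ; 1≤current = 1≤d ; current<top = d<t }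
enterBy M s rows d 1≤d (inj₂ _) = appendNode M s rows d

lowDigit highDigits : Node → Node
lowDigit N = appendNode matrix state rows current
  where open Node N
highDigits N = enterBy matrix state rows (ℕ.suc current) (ℕ.s≤s ℕ.z≤n) (ℕ.m≤n⇒m<n∨m≡n current<top)
  where open Node N

-- Turns refer to left and right on the line, nodes to digits. The smaller digit is on the left
-- exactly if the map is rising.
child : Bool → Node → Node
child b N = if b xor Matrix.rising (Node.matrix N) then lowDigit N else highDigits N

-- Logarithmic coordinates and the bridge inequalities

module Coordinates {c ℓ₁ ℓ₂} {ℝ : RealField c ℓ₁ ℓ₂} (ln : NaturalLogarithm ℝ) where
  open RealField ℝ hiding (zero)
  open OrderedField ℝ
  open NaturalLogarithm ln
  open LogInequalities ln
  open ContinuedFractionValues ℝ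
  open ExtremeValues ℝ

  Positive : Set _
  Positive = ∃[ x ] 0# < x

  affine : ℕ → ℕ → Carrier → Carrier
  affine m n t = fromℕ m * t + fromℕ n

  affine-pos : ∀ {m n t} → 1 ℕ.≤ n → 0# < t → 0# < affine m n t
  affine-pos {m} {n} 1≤n 0<t = +-nonneg-pos (*-nonneg (fromℕ-nonneg m) (<⇒≤ 0<t)) (fromℕ-pos n 1≤n)

  affine-mono : ∀ {m n s t} → s ≤ t → affine m n s ≤ affine m n t
  affine-mono {m} {n} s≤t = +-monoˡ-≤ (fromℕ n) (*-monoˡ-≤ (fromℕ m) (fromℕ-nonneg m) s≤t)

  -- Both rows acquire the same factor t′, which cancels in the quotient of numerator and
  -- denominator.
  affine-append : ∀ m n {d t t′} → Step d t′ t → affine (m ℕ.* d ℕ.+ n) m t′ ≈ t′ * affine m n t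
  affine-append m n {d} {t} {t′} (step eq) = trans
    (+-congʳ (*-congʳ (trans (fromℕ-+ (m ℕ.* d) n) (+-congʳ (fromℕ-* m d)))))
    (trans (solve 4 (λ m n d t′ → (m :* d :+ n) :* t′ :+ m := m :* (d :* t′ :+ con (+ 1)) :+ t′ :* n)
        refl (fromℕ m) (fromℕ n) (fromℕ d) t′)
      (trans (+-congʳ (*-congˡ (sym eq)))
        (solve 4 (λ m n t t′ → m :* (t :* t′) :+ t′ :* n := t′ :* (m :* t :+ n)) refl (fromℕ m) (fromℕ n) t t′)))

  module _ (M : Matrix) where
    open Matrix M

    numerator denominator : Positive → Carrier
    numerator   (t , _) = affine u u′ t
    denominator (t , _) = affine v v′ t

    numerator-pos : ∀ t → 0# < numerator t
    numerator-pos (t , 0<t) = affine-pos {u} {u′} 1≤u′ 0<t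

    denominator-pos : ∀ t → 0# < denominator t
    denominator-pos (t , 0<t) = affine-pos {v} {v′} 1≤v′ 0<t

    abstract
      logMöbius : Positive → Carrier
      logMöbius t = log (numerator t) (numerator-pos t) - log (denominator t) (denominator-pos t)

      logMöbius-def : ∀ t → logMöbius t ≈ log (numerator t) (numerator-pos t) - log (denominator t) (denominator-pos t)
      logMöbius-def t = refl

      private
        cross-pos : ∀ s t → 0# < numerator s * denominator t
        cross-pos s t = *-pos (numerator-pos s) (denominator-pos t)

        -- This is where the determinant 1 enters; cross-multiplying the two fractions allows the
        -- bounds for log to be used without quotients.
        cross-difference : ∀ s t → numerator t * denominator s - numerator s * denominator t ≈ proj₁ t - proj₁ s
        cross-difference (s , _) (t , _) = trans
          (solve 6 (λ u u′ v v′ s t → (u :* t :+ u′) :* (v :* s :+ v′) :- (u :* s :+ u′) :* (v :* t :+ v′)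
             := (u :* v′) :* (t :- s) :- (u′ :* v) :* (t :- s)) refl
             (fromℕ u) (fromℕ u′) (fromℕ v) (fromℕ v′) s t)
          (trans (+-congʳ (*-congʳ uv′≈))
            (solve 3 (λ p s t → (con (+ 1) :+ p) :* (t :- s) :- p :* (t :- s) := t :- s) refl (fromℕ u′ * fromℕ v) s t))
          where
          uv′≈ : fromℕ u * fromℕ v′ ≈ fromℕ 1 + fromℕ u′ * fromℕ v
          uv′≈ = trans (sym (fromℕ-* u v′)) (trans (reflexive (≡.cong fromℕ det))
            (trans (fromℕ-+ 1 (u′ ℕ.* v)) (+-congˡ (fromℕ-* u′ v))))

        log-cross : ∀ s t → log (numerator t * denominator s) (cross-pos t s) -
                            log (numerator s * denominator t) (cross-pos s t) ≈ logMöbius t - logMöbius s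
        log-cross s t = trans
          (+-cong (log-* _ _ (numerator-pos t) (denominator-pos s))
            (-‿cong (log-* _ _ (numerator-pos s) (denominator-pos t))))
          (solve 4 (λ a b c d → (a :+ b) :- (c :+ d) := (a :- d) :- (c :- b)) refl _ _ _ _)

      logMöbius-upper : ∀ s t → numerator s * denominator t * (logMöbius t - logMöbius s) ≤ proj₁ t - proj₁ s
      logMöbius-upper s t = ≤-resp (*-congˡ (log-cross s t)) (cross-difference s t)
        (log-upper (cross-pos s t) (cross-pos t s))

      logMöbius-lower : ∀ s t → proj₁ t - proj₁ s ≤ numerator t * denominator s * (logMöbius t - logMöbius s)
      logMöbius-lower s t = ≤-resp (cross-difference s t) (*-congˡ (log-cross s t))
        (log-lower (cross-pos s t) (cross-pos t s))

    logMöbius-mono-≤ : ∀ s t → proj₁ s ≤ proj₁ t → logMöbius s ≤ logMöbius t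
    logMöbius-mono-≤ s t s≤t = 0≤y-x⇒x≤y (*-cancelˡ-≤ p 0<p (≤-resp (sym (zeroʳ p)) refl
      (≤-trans (x≤y⇒0≤y-x s≤t) (logMöbius-lower s t))))
      where
      p = numerator t * denominator s
      0<p = *-pos (numerator-pos t) (denominator-pos s)

    logMöbius-mono-< : ∀ s t → proj₁ s < proj₁ t → logMöbius s < logMöbius t
    logMöbius-mono-< s t s<t = 0<y-x⇒x<y (*-cancelˡ-< p 0<p (<-resp (sym (zeroʳ p)) refl
      (<-≤-trans (x<y⇒0<y-x s<t) (logMöbius-lower s t))))
      where
      p = numerator t * denominator s
      0<p = *-pos (numerator-pos t) (denominator-pos s)

    logMöbius-cong : ∀ s t → proj₁ s ≈ proj₁ t → logMöbius s ≈ logMöbius t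
    logMöbius-cong s t s≈t = ≤-antisym
      (logMöbius-mono-≤ s t (≤-reflexive s≈t)) (logMöbius-mono-≤ t s (≤-reflexive (sym s≈t)))

    -- The upper bound for the gap has the factor N(a) D(b), the lower bound for the bridge N(a)
    -- D(c₀), with N and D the numerator and denominator. As D(c₀) ≤ D(b), the plain inequality
    -- between the tails suffices for every matrix.
    bridge-belowᵐ : ∀ {T S} c₀ a b → proj₁ c₀ ≤ proj₁ a → proj₁ a ≤ proj₁ b →
      fromℕ T * (proj₁ b - proj₁ a) ≤ fromℕ S * (proj₁ a - proj₁ c₀) →
      fromℕ T * (logMöbius b - logMöbius a) ≤ fromℕ S * (logMöbius a - logMöbius c₀)
    bridge-belowᵐ {T} {S} c₀ a b c≤a a≤b T[b-a]≤S[a-c] = *-cancelˡ-≤ (numerator a * denominator b)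
      (*-pos (numerator-pos a) (denominator-pos b))
      (≤-trans (≤-resp (exchange (fromℕ T) _ _) refl (*-monoˡ-≤ (fromℕ T) (fromℕ-nonneg T) (logMöbius-upper a b)))
        (≤-trans T[b-a]≤S[a-c] (≤-resp refl (exchange (fromℕ S) _ _) (*-monoˡ-≤ (fromℕ S) (fromℕ-nonneg S)
          (≤-trans (logMöbius-lower c₀ a) (*-monoʳ-≤ _ (x≤y⇒0≤y-x (logMöbius-mono-≤ c₀ a c≤a))
            (*-monoˡ-≤ (numerator a) (<⇒≤ (numerator-pos a)) (affine-mono {v} {v′} (≤-trans c≤a a≤b)))))))))
      where
      exchange : ∀ x y z → x * (y * z) ≈ y * (x * z)
      exchange = solve 3 (λ x y z → x :* (y :* z) := y :* (x :* z)) refl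

    -- Here the factors are N(a) D(b) for the gap and N(h) D(b) for the bridge. D(b) cancels, but
    -- N(h) is larger than N(a), so both numerators remain in the hypothesis.
    bridge-aboveᵐ : ∀ {T S} a b h →
      fromℕ T * (proj₁ b - proj₁ a) * numerator h ≤ fromℕ S * (proj₁ h - proj₁ b) * numerator a →
      fromℕ T * (logMöbius b - logMöbius a) ≤ fromℕ S * (logMöbius h - logMöbius b)
    bridge-aboveᵐ {T} {S} a b h hyp = *-cancelˡ-≤ (nₐ * dᵦ * nₕ)
      (*-pos (*-pos (numerator-pos a) (denominator-pos b)) (numerator-pos h))
      (≤-trans (≤-resp
          (solve 5 (λ t x a b h → (t :* h) :* (a :* b :* x) := (a :* b :* h) :* (t :* x)) refl
            (fromℕ T) (logMöbius b - logMöbius a) nₐ dᵦ nₕ)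
          (solve 3 (λ t x h → (t :* h) :* x := t :* x :* h) refl (fromℕ T) (proj₁ b - proj₁ a) nₕ)
          (*-monoˡ-≤ (fromℕ T * nₕ) (*-nonneg (fromℕ-nonneg T) (<⇒≤ (numerator-pos h))) (logMöbius-upper a b)))
        (≤-trans hyp (≤-resp
          (solve 3 (λ t x h → (t :* h) :* x := t :* x :* h) refl (fromℕ S) (proj₁ h - proj₁ b) nₐ)
          (solve 5 (λ t x a b h → (t :* a) :* (h :* b :* x) := (a :* b :* h) :* (t :* x)) refl
            (fromℕ S) (logMöbius h - logMöbius b) nₐ dᵦ nₕ)
          (*-monoˡ-≤ (fromℕ S * nₐ) (*-nonneg (fromℕ-nonneg S) (<⇒≤ (numerator-pos a))) (logMöbius-lower b h)))))
      where
      nₐ = numerator a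
      nₕ = numerator h
      dᵦ = denominator b

    -- 5 (u t + u′) = u (5 t + w) + (5 u′ − w u), with both terms
    -- nonnegative.
    weighted : ∀ {w T S} (a b h : Positive) → w ℕ.* u ℕ.≤ 5 ℕ.* u′ → proj₁ a ≤ proj₁ b → proj₁ b ≤ proj₁ h →
      fromℕ T * (proj₁ b - proj₁ a) * (fromℕ 5 * proj₁ h + fromℕ w) ≤
      fromℕ S * (proj₁ h - proj₁ b) * (fromℕ 5 * proj₁ a + fromℕ w) →
      fromℕ T * (proj₁ b - proj₁ a) * numerator h ≤ fromℕ S * (proj₁ h - proj₁ b) * numerator a
    weighted {w} {T} {S} a⁺@(a , 0<a) b⁺@(b , _) h⁺@(h , 0<h) wu≤5u′ a≤b b≤h hyp =
      *-cancelˡ-≤ (fromℕ 5) (fromℕ-pos 5 (ℕ.s≤s ℕ.z≤n))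
        (≤-resp (sym (split X h)) (sym (split Y a)) (+-mono-≤
          (*-monoˡ-≤ (fromℕ u) (fromℕ-nonneg u) hyp)
          (*-monoˡ-≤ R 0≤R X≤Y)))
      where
      X = fromℕ T * (b - a)
      Y = fromℕ S * (h - b)
      R = fromℕ 5 * fromℕ u′ - fromℕ w * fromℕ u
      0≤R : 0# ≤ R
      0≤R = x≤y⇒0≤y-x (≤-resp (fromℕ-* w u) (fromℕ-* 5 u′) (fromℕ-mono-≤ wu≤5u′))
      5t+w>0 : ∀ {t} → 0# < t → 0# < fromℕ 5 * t + fromℕ w
      5t+w>0 0<t = +-pos-nonneg (*-pos (fromℕ-pos 5 (ℕ.s≤s ℕ.z≤n)) 0<t) (fromℕ-nonneg w)
      -- The second term needs the inequality without its linear factors; it follows as 5 a + w ≤ 5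
      -- h + w and the latter is positive.
      X≤Y : X ≤ Y
      X≤Y = *-cancelˡ-≤ (fromℕ 5 * h + fromℕ w) (5t+w>0 0<h)
        (≤-resp (*-comm _ _) (*-comm _ _) (≤-trans hyp
          (*-monoˡ-≤ Y (*-nonneg (fromℕ-nonneg S) (x≤y⇒0≤y-x b≤h)) (affine-mono {5} {w} (≤-trans a≤b b≤h)))))
      split : ∀ x t → fromℕ 5 * (x * affine u u′ t) ≈
              fromℕ u * (x * (fromℕ 5 * t + fromℕ w)) + R * x
      split x t = solve 6 (λ f u u′ w x t → f :* (x :* (u :* t :+ u′)) :=
        u :* (x :* (f :* t :+ w)) :+ (f :* u′ :- w :* u) :* x) refl (fromℕ 5) (fromℕ u) (fromℕ u′) (fromℕ w) x t

    -- For s ≥ 1 the numerator is at least u, and the denominator is at least 1. This crude bound of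
    -- the order 1 / u is enough to make nested intervals shrink to a point.
    logMöbius-width : ∀ {n} s t → n ℕ.≤ u → InRange (proj₁ s) → proj₁ t ≤ fromℕ 5 → proj₁ s ≤ proj₁ t →
                      fromℕ n * (logMöbius t - logMöbius s) ≤ fromℕ 5
    logMöbius-width {n} s⁺@(s , _) t⁺@(t , 0<t) n≤u s∈ t≤5 s≤t = ≤-trans
      (*-monoʳ-≤ (logMöbius t⁺ - logMöbius s⁺) (x≤y⇒0≤y-x (logMöbius-mono-≤ s⁺ t⁺ s≤t)) n≤nd)
      (≤-trans (logMöbius-upper s⁺ t⁺) (≤-trans (≤-by (<⇒≤ (0< s∈))
        (solve 2 (λ s t → t :- (t :- s) := s) refl s t)) t≤5))
      where
      n≤num : fromℕ n ≤ numerator s⁺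
      n≤num = ≤-trans (fromℕ-mono-≤ n≤u) (≤-by
        (+-nonneg (*-nonneg (fromℕ-nonneg u) (x≤y⇒0≤y-x (1≤ s∈))) (fromℕ-nonneg u′))
        (solve 3 (λ u u′ s → (u :* s :+ u′) :- u := u :* (s :- con (+ 1)) :+ u′) refl (fromℕ u) (fromℕ u′) s))
      1≤den : fromℕ 1 ≤ denominator t⁺
      1≤den = ≤-trans (fromℕ-mono-≤ 1≤v′) (≤-by (*-nonneg (fromℕ-nonneg v) (<⇒≤ 0<t))
        (solve 2 (λ p v′ → (p :+ v′) :- v′ := p) refl (fromℕ v * t) (fromℕ v′)))
      n≤nd : fromℕ n ≤ numerator s⁺ * denominator t⁺
      n≤nd = ≤-resp (trans (*-congˡ fromℕ-1) (*-identityʳ (fromℕ n))) refl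
        (*-mono-≤ (fromℕ-nonneg n) (<⇒≤ (denominator-pos t⁺)) n≤num 1≤den)

  -- The common factor t′ drops out of the difference of logarithms, and the exchange of the rows
  -- changes its sign.
  logMöbius-append : ∀ M d (t t′ : Positive) → Step d (proj₁ t′) (proj₁ t) →
                     logMöbius (append M d) t′ ≈ - logMöbius M t
  logMöbius-append M d t⁺@(t , 0<t) t′⁺@(t′ , 0<t′) st = trans (logMöbius-def (append M d) t′⁺) (trans
    (+-cong (log-append v v′ (numerator-pos (append M d) t′⁺) (denominator-pos M t⁺))
            (-‿cong (log-append u u′ (denominator-pos (append M d) t′⁺) (numerator-pos M t⁺))))
    (trans (solve 3 (λ l x y → (l :+ y) :- (l :+ x) := :- (x :- y)) refl
        (log t′ 0<t′) (log (affine u u′ t) (numerator-pos M t⁺)) (log (affine v v′ t) (denominator-pos M t⁺)))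
      (-‿cong (sym (logMöbius-def M t⁺)))))
    where
    open Matrix M
    log-append : ∀ m n (p : 0# < affine (m ℕ.* d ℕ.+ n) m t′) (q : 0# < affine m n t) →
                 log (affine (m ℕ.* d ℕ.+ n) m t′) p ≈ log t′ 0<t′ + log (affine m n t) q
    log-append m n p q = trans (log-cong p (*-pos 0<t′ q) (affine-append m n st)) (log-* t′ _ 0<t′ q)

  valueᵖ : Digits → Positive
  valueᵖ a = value a , value-pos a

  lowᵖ highᵖ : State → Positive
  lowᵖ  s = valueᵖ (least s)
  highᵖ s = valueᵖ (greatest s)

  startᵖ endᵖ : State → ℕ → Positive
  startᵖ s d = start s d , start-pos s d
  endᵖ   s d = end s d , end-pos s d

  orient : Bool → Carrier → Carrier
  orient true  x = x
  orient false x = - x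

  -- The end points of the interval between orient r x and orient r y,
  -- for x ≤ y.
  lower upper : Bool → Carrier → Carrier → Carrier
  lower true  x y = x
  lower false x y = - y
  upper true  x y = y
  upper false x y = - x

  orient-cong : ∀ r {x x′} → x ≈ x′ → orient r x ≈ orient r x′
  orient-cong true  x≈ = x≈
  orient-cong false x≈ = -‿cong x≈

  orient-not : ∀ r {x x′} → x′ ≈ - x → orient (not r) x′ ≈ orient r x
  orient-not true  x′≈ = trans (-‿cong x′≈) (solve 1 (λ x → :- :- x := x) refl _)
  orient-not false x′≈ = x′≈

  lower-cong : ∀ r {x x′ y y′} → x ≈ x′ → y ≈ y′ → lower r x y ≈ lower r x′ y′
  lower-cong true  x≈ y≈ = x≈
  lower-cong false x≈ y≈ = -‿cong y≈

  upper-cong : ∀ r {x x′ y y′} → x ≈ x′ → y ≈ y′ → upper r x y ≈ upper r x′ y′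
  upper-cong true  x≈ y≈ = y≈
  upper-cong false x≈ y≈ = -‿cong x≈

  lower-not : ∀ r {x x′ y y′} → x′ ≈ - y → y′ ≈ - x → lower (not r) x′ y′ ≈ lower r x y
  lower-not true  x′≈ y′≈ = orient-not true y′≈
  lower-not false x′≈ y′≈ = x′≈

  upper-not : ∀ r {x x′ y y′} → x′ ≈ - y → y′ ≈ - x → upper (not r) x′ y′ ≈ upper r x y
  upper-not true  x′≈ y′≈ = orient-not true x′≈
  upper-not false x′≈ y′≈ = y′≈

  lower≤orient : ∀ r {x y z} → x ≤ z → z ≤ y → lower r x y ≤ orient r z
  lower≤orient true  x≤z z≤y = x≤z
  lower≤orient false x≤z z≤y = -‿mono-≤ z≤y

  orient≤upper : ∀ r {x y z} → x ≤ z → z ≤ y → orient r z ≤ upper r x y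
  orient≤upper true  x≤z z≤y = z≤y
  orient≤upper false x≤z z≤y = -‿mono-≤ x≤z

  -‿difference : ∀ x y → - x - - y ≈ y - x
  -‿difference = solve 2 (λ x y → :- x :- (:- y) := y :- x) refl

  upper-lower : ∀ r {x y} → upper r x y - lower r x y ≈ y - x
  upper-lower true  = refl
  upper-lower false = -‿difference _ _

  module _ (N : Node) where
    open Node N
    open Matrix matrix using (rising)

    private
      f = logMöbius matrix

    nodeLo nodeGapLo nodeGapHi nodeHi : Carrier
    nodeLo    = lower rising (f (startᵖ state current)) (f (highᵖ state))
    nodeGapLo = lower rising (f (endᵖ state current)) (f (startᵖ state (ℕ.suc current)))
    nodeGapHi = upper rising (f (endᵖ state current)) (f (startᵖ state (ℕ.suc current)))
    nodeHi    = upper rising (f (startᵖ state current)) (f (highᵖ state))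

    private
      start<end′ : f (startᵖ state current) < f (endᵖ state current)
      start<end′ = logMöbius-mono-< matrix _ _ (start<end state current)

      end<start′ : f (endᵖ state current) < f (startᵖ state (ℕ.suc current))
      end<start′ = logMöbius-mono-< matrix _ _ (end<start state ℕ.≤-refl)

      start<high : start state (ℕ.suc current) < high state
      start<high = <-≤-trans (start<end state (ℕ.suc current)) (end≤high state current<top)

      start<high′ : f (startᵖ state (ℕ.suc current)) < f (highᵖ state)
      start<high′ = logMöbius-mono-< matrix _ _ start<high

    lo<gapLo : nodeLo < nodeGapLo
    lo<gapLo = case rising
      where
      case : ∀ r → lower r (f (startᵖ state current)) (f (highᵖ state)) <
                   lower r (f (endᵖ state current)) (f (startᵖ state (ℕ.suc current)))
      case true  = start<end′
      case false = -‿mono-< start<high′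

    gapLo<gapHi : nodeGapLo < nodeGapHi
    gapLo<gapHi = case rising
      where
      case : ∀ r → lower r (f (endᵖ state current)) (f (startᵖ state (ℕ.suc current))) <
                   upper r (f (endᵖ state current)) (f (startᵖ state (ℕ.suc current)))
      case true  = end<start′
      case false = -‿mono-< end<start′

    gapHi<hi : nodeGapHi < nodeHi
    gapHi<hi = case rising
      where
      case : ∀ r → upper r (f (endᵖ state current)) (f (startᵖ state (ℕ.suc current))) <
                   upper r (f (startᵖ state current)) (f (highᵖ state))
      case true  = start<high′
      case false = -‿mono-< start<end′

    module _ {T S} (marginˡ : Marginˡ T S) (marginʳ : Marginʳ T S) where

      private
        bridge-low : fromℕ T * (f (startᵖ state (ℕ.suc current)) - f (endᵖ state current)) ≤
                     fromℕ S * (f (endᵖ state current) - f (startᵖ state current))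
        bridge-low = bridge-belowᵐ matrix {T} {S} (startᵖ state current) (endᵖ state current) (startᵖ state (ℕ.suc current))
          (<⇒≤ (start<end state current)) (<⇒≤ (end<start state ℕ.≤-refl)) (marginˡ state current 1≤current current<top)

        bridge-high : fromℕ T * (f (startᵖ state (ℕ.suc current)) - f (endᵖ state current)) ≤
                      fromℕ S * (f (highᵖ state) - f (startᵖ state (ℕ.suc current)))
        bridge-high = bridge-aboveᵐ matrix {T} {S} (endᵖ state current) (startᵖ state (ℕ.suc current)) (highᵖ state)
          (weighted matrix {weight state} {T} {S} (endᵖ state current) (startᵖ state (ℕ.suc current)) (highᵖ state)
            (row-weight state _ _ (proj₁ rows)) (<⇒≤ (end<start state ℕ.≤-refl)) (<⇒≤ start<high)
            (marginʳ state current 1≤current current<top))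

      -- If the map is not rising, the reflection exchanges the bridges: the left one then belongs
      -- to the higher digits.
      boundˡ : fromℕ T * (nodeGapHi - nodeGapLo) ≤ fromℕ S * (nodeGapLo - nodeLo)
      boundˡ = ≤-resp (*-congˡ (sym (upper-lower rising))) refl (case rising)
        where
        case : ∀ r → fromℕ T * (f (startᵖ state (ℕ.suc current)) - f (endᵖ state current)) ≤
          fromℕ S * (lower r (f (endᵖ state current)) (f (startᵖ state (ℕ.suc current))) -
                     lower r (f (startᵖ state current)) (f (highᵖ state)))
        case true  = bridge-low
        case false = ≤-resp refl (*-congˡ (sym (-‿difference _ _))) bridge-high

      boundʳ : fromℕ T * (nodeGapHi - nodeGapLo) ≤ fromℕ S * (nodeHi - nodeGapHi)
      boundʳ = ≤-resp (*-congˡ (sym (upper-lower rising))) refl (case rising)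
        where
        case : ∀ r → fromℕ T * (f (startᵖ state (ℕ.suc current)) - f (endᵖ state current)) ≤
          fromℕ S * (upper r (f (startᵖ state current)) (f (highᵖ state)) -
                     upper r (f (endᵖ state current)) (f (startᵖ state (ℕ.suc current))))
        case true  = bridge-high
        case false = ≤-resp refl (*-congˡ (sym (-‿difference _ _))) bridge-low

  module _ (M : Matrix) (s : State) (rows : Rows s M) where
    open Matrix M using (rising)

    private
      f = logMöbius M

      low-append : ∀ d → logMöbius (append M d) (startᵖ (move s d) 1) ≈ - f (endᵖ s d)
      low-append d = trans
        (logMöbius-cong (append M d) (startᵖ (move s d) 1) (lowᵖ (move s d)) (sym (low≈start (move s d))))
        (logMöbius-append M d (endᵖ s d) (lowᵖ (move s d)) (end-step s d))

      high-append : ∀ d → logMöbius (append M d) (highᵖ (move s d)) ≈ - f (startᵖ s d)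
      high-append d = logMöbius-append M d (startᵖ s d) (highᵖ (move s d)) (start-step s d)

    appendNode-lo : ∀ d → nodeLo (appendNode M s rows d) ≈ lower rising (f (startᵖ s d)) (f (endᵖ s d))
    appendNode-lo d = lower-not rising (low-append d) (high-append d)

    appendNode-hi : ∀ d → nodeHi (appendNode M s rows d) ≈ upper rising (f (startᵖ s d)) (f (endᵖ s d))
    appendNode-hi d = upper-not rising (low-append d) (high-append d)

    private
      end-top : ∀ {d} → d ≡ top s → f (endᵖ s d) ≈ f (highᵖ s)
      end-top ≡.refl = logMöbius-cong M (endᵖ s (top s)) (highᵖ s) (sym (high≈end s))

    -- For d = `top s` the end of the block of d is `high s`, so both kinds of vertex have the same
    -- end points.
    enterBy-lo : ∀ d 1≤d i → nodeLo (enterBy M s rows d 1≤d i) ≈ lower rising (f (startᵖ s d)) (f (highᵖ s))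
    enterBy-lo d 1≤d (inj₁ _)   = refl
    enterBy-lo d 1≤d (inj₂ d≡t) = trans (appendNode-lo d) (lower-cong rising refl (end-top d≡t))

    enterBy-hi : ∀ d 1≤d i → nodeHi (enterBy M s rows d 1≤d i) ≈ upper rising (f (startᵖ s d)) (f (highᵖ s))
    enterBy-hi d 1≤d (inj₁ _)   = refl
    enterBy-hi d 1≤d (inj₂ d≡t) = trans (appendNode-hi d) (upper-cong rising refl (end-top d≡t))

  module _ (N : Node) where
    open Node N
    open Matrix matrix using (rising)

    private
      f = logMöbius matrix
      x₁ = f (startᵖ state current)
      x₂ = f (endᵖ state current)
      x₃ = f (startᵖ state (ℕ.suc current))
      x₄ = f (highᵖ state)

      low-lo : nodeLo (lowDigit N) ≈ lower rising x₁ x₂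
      low-lo = appendNode-lo matrix state rows current
      low-hi : nodeHi (lowDigit N) ≈ upper rising x₁ x₂
      low-hi = appendNode-hi matrix state rows current
      high-lo : nodeLo (highDigits N) ≈ lower rising x₃ x₄
      high-lo = enterBy-lo matrix state rows (ℕ.suc current) _ (ℕ.m≤n⇒m<n∨m≡n current<top)
      high-hi : nodeHi (highDigits N) ≈ upper rising x₃ x₄
      high-hi = enterBy-hi matrix state rows (ℕ.suc current) _ (ℕ.m≤n⇒m<n∨m≡n current<top)

      childOf : Bool → Bool → Node
      childOf b r = if b xor r then lowDigit N else highDigits N

    child-false-lo : nodeLo (child false N) ≈ nodeLo N
    child-false-lo = case rising low-lo high-lo
      where
      case : ∀ r → nodeLo (lowDigit N) ≈ lower r x₁ x₂ → nodeLo (highDigits N) ≈ lower r x₃ x₄ →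
             nodeLo (childOf false r) ≈ lower r x₁ x₄
      case true  l h = l
      case false l h = h

    child-false-hi : nodeHi (child false N) ≈ nodeGapLo N
    child-false-hi = case rising low-hi high-hi
      where
      case : ∀ r → nodeHi (lowDigit N) ≈ upper r x₁ x₂ → nodeHi (highDigits N) ≈ upper r x₃ x₄ →
             nodeHi (childOf false r) ≈ lower r x₂ x₃
      case true  l h = l
      case false l h = h

    child-true-lo : nodeLo (child true N) ≈ nodeGapHi N
    child-true-lo = case rising low-lo high-lo
      where
      case : ∀ r → nodeLo (lowDigit N) ≈ lower r x₁ x₂ → nodeLo (highDigits N) ≈ lower r x₃ x₄ →
             nodeLo (childOf true r) ≈ upper r x₂ x₃
      case true  l h = h
      case false l h = l

    child-true-hi : nodeHi (child true N) ≈ nodeHi N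
    child-true-hi = case rising low-hi high-hi
      where
      case : ∀ r → nodeHi (lowDigit N) ≈ upper r x₁ x₂ → nodeHi (highDigits N) ≈ upper r x₃ x₄ →
             nodeHi (childOf true r) ≈ upper r x₁ x₄
      case true  l h = h
      case false l h = l

-- Paths in the tree and the extraction of digits from them

nodeAt : Word → Node
nodeAt []      = freshNode rootMatrix free (tt , tt)
nodeAt (b ∷ w) = child b (nodeAt w)

record Point {ℓ} (At : Matrix → Digits → Set ℓ) (N : Node) : Set ℓ where
  open Node N using (matrix; state)
  field
    digits     : Digits
    admissible : Admissible state (Digits.digit digits)
    current≤     : Node.current N ℕ.≤ Digits.head digits
    at         : At matrix digits

module Search {ℓ} (Inside : Word → Set ℓ) (split : ∀ w → Inside w → ∃[ b ] Inside (b ∷ w)) where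

  -- A vertex on the path of the point where a new digit is about to be split; between two of them
  -- the path decides exactly one digit.
  record Spot (M : Matrix) (s : State) : Set ℓ where
    field
      rows   : Rows s M
      w      : Word
      at     : nodeAt w ≡ freshNode M s rows
      inside : Inside w

  record Choice (M : Matrix) (s : State) : Set ℓ where
    field
      d    : ℕ
      1≤d  : 1 ℕ.≤ d
      d≤t  : d ℕ.≤ top s
      next : Spot (append M d) (move s d)

  module _ (M : Matrix) (s : State) (rows : Rows s M) where

    private
      nodeFrom : ∀ d → 1 ℕ.≤ d → d ℕ.< top s → Node
      nodeFrom d 1≤d d<t = enterBy M s rows d 1≤d (inj₁ d<t)

    -- Every turn towards the higher digits raises d. The fuel bounds the digits still to be
    -- excluded, and at zero d would have reached `top s`, where no gap is left.
    search : ∀ fuel d 1≤d d<t → top s ℕ.≤ fuel ℕ.+ d → ∀ w → nodeAt w ≡ nodeFrom d 1≤d d<t →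
             Inside w → Choice M s
    search ℕ.zero d 1≤d d<t t≤d w at y∈ = ⊥-elim (ℕ.<⇒≱ d<t t≤d)
    search (ℕ.suc fuel) d 1≤d d<t t≤ w at y∈ = turn (split w y∈)
      where
      N = nodeFrom d 1≤d d<t

      enter : ∀ b → Inside (b ∷ w) → ∀ i →
              nodeAt (b ∷ w) ≡ enterBy M s rows (ℕ.suc d) (ℕ.s≤s ℕ.z≤n) i → Choice M s
      enter b y∈ (inj₁ d+1<t) at = search fuel (ℕ.suc d) (ℕ.s≤s ℕ.z≤n) d+1<t
        (ℕ.≤-trans t≤ (ℕ.≤-reflexive (≡.sym (ℕ.+-suc fuel d)))) (b ∷ w) at y∈
      enter b y∈ (inj₂ d+1≡t) at = record
        { d = ℕ.suc d ; 1≤d = ℕ.s≤s ℕ.z≤n ; d≤t = d<t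
        ; next = record { rows = rows-append s (ℕ.suc d) M rows ; w = b ∷ w ; at = at ; inside = y∈ } }

      choose : ∀ b → Inside (b ∷ w) → ∀ low →
               nodeAt (b ∷ w) ≡ (if low then lowDigit N else highDigits N) → Choice M s
      choose b y∈ true at = record
        { d = d ; 1≤d = 1≤d ; d≤t = ℕ.<⇒≤ d<t
        ; next = record { rows = rows-append s d M rows ; w = b ∷ w ; at = at ; inside = y∈ } }
      choose b y∈ false at = enter b y∈ (ℕ.m≤n⇒m<n∨m≡n d<t) at

      turn : ∃[ b ] Inside (b ∷ w) → Choice M s
      turn (b , y∈) = choose b y∈ (b xor Matrix.rising M) (≡.cong (child b) at)

  choice : ∀ {M s} → Spot M s → Choice M s
  choice {M} {s} S = search M s rows (top s) 1 ℕ.≤-refl (2≤top s) (ℕ.m≤m+n (top s) 1) w at inside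
    where open Spot S

  digitsFrom : ∀ {M s} → Spot M s → ℕ → ℕ
  digitsFrom S ℕ.zero    = Choice.d (choice S)
  digitsFrom S (ℕ.suc n) = digitsFrom (Choice.next (choice S)) n

  digitsFrom≥1 : ∀ {M s} (S : Spot M s) n → 1 ℕ.≤ digitsFrom S n
  digitsFrom≥1 S ℕ.zero    = Choice.1≤d (choice S)
  digitsFrom≥1 S (ℕ.suc n) = digitsFrom≥1 (Choice.next (choice S)) n

  digitsFrom-admissible : ∀ {M s} (S : Spot M s) → Admissible s (digitsFrom S)
  digitsFrom-admissible S ℕ.zero    = Choice.d≤t (choice S)
  digitsFrom-admissible S (ℕ.suc n) = digitsFrom-admissible (Choice.next (choice S)) n

  digitsFrom≤4 : ∀ {M s} (S : Spot M s) n → digitsFrom S n ℕ.≤ 4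
  digitsFrom≤4 {s = s} S n = ℕ.≤-trans (digitsFrom-admissible S n) (top≤4 (run s (digitsFrom S) n))

  from : ∀ {M s} → Spot M s → Digits
  from S = record { digit = digitsFrom S ; ≥1 = digitsFrom≥1 S ; ≤4 = digitsFrom≤4 S }

-- The tree cuts out exactly the logarithms of F₄*

module LogF₄* {c ℓ₁ ℓ₂} {ℝ : RealField c ℓ₁ ℓ₂} (ln : NaturalLogarithm ℝ) where
  open RealField ℝ hiding (zero)
  open OrderedField ℝ
  open NaturalLogarithm ln
  open ContinuedFractions ℝ
  open Thickness ℝ
  open IntervalTrees ℝ
  open ContinuedFractionValues ℝ
  open ExtremeValues ℝ
  open Coordinates ln
  open Digits

  tree : IntervalTree
  tree = record
    { lo = nodeLo ∘ nodeAt
    ; gl = nodeGapLo ∘ nodeAt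
    ; gh = nodeGapHi ∘ nodeAt
    ; hi = nodeHi ∘ nodeAt
    ; lo<gl = lo<gapLo ∘ nodeAt
    ; gl<gh = gapLo<gapHi ∘ nodeAt
    ; gh<hi = gapHi<hi ∘ nodeAt
    ; lo-false = child-false-lo ∘ nodeAt
    ; hi-false = child-false-hi ∘ nodeAt
    ; lo-true  = child-true-lo ∘ nodeAt
    ; hi-true  = child-true-hi ∘ nodeAt
    }
  open IntervalTree tree

  coordinate : Matrix → Digits → Carrier
  coordinate M a = orient (Matrix.rising M) (logMöbius M (valueᵖ a))

  coordinate-append : ∀ M a d → d ≡ head a → coordinate (append M d) (tail a) ≈ coordinate M a
  coordinate-append M a d ≡.refl = orient-not (Matrix.rising M)
    (logMöbius-append M (head a) (valueᵖ a) (valueᵖ (tail a)) (value-step a))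

  PointAt : Node → Carrier → Set ℓ₁
  PointAt N y = Point (λ M a → y ≈ coordinate M a) N

  point-inside : ∀ N {y} → PointAt N y → nodeLo N ≤ y × y ≤ nodeHi N
  point-inside N P =
    ≤-resp refl (sym at) (lower≤orient rising start≤value value≤high) ,
    ≤-resp (sym at) refl (orient≤upper rising start≤value value≤high)
    where
    open Point P
    open Node N using (matrix; state)
    open Matrix matrix using (rising)
    start≤value = logMöbius-mono-≤ matrix (startᵖ state (Node.current N)) (valueᵖ digits)
      (start≤admissible digits admissible current≤)
    value≤high  = logMöbius-mono-≤ matrix (valueᵖ digits) (highᵖ state)
      (admissible≤high digits admissible)

  module _ (M : Matrix) (s : State) (rows : Rows s M) (a : Digits) (adm : Admissible s (digit a))
           {y} (y≈ : y ≈ coordinate M a) where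

    point-append : ∀ d → d ≡ head a → PointAt (appendNode M s rows d) y
    point-append d d≡ = record
      { digits      = tail a
      ; admissible  = ≡.subst (λ e → Admissible (move s e) (digit (tail a))) (≡.sym d≡) (adm ∘ ℕ.suc)
      ; current≤      = ≥1 (tail a) 0
      ; at = trans y≈ (sym (coordinate-append M a d d≡))
      }

    point-enterBy : ∀ d 1≤d i → d ℕ.≤ head a → PointAt (enterBy M s rows d 1≤d i) y
    point-enterBy d 1≤d (inj₁ _) d≤ = record
      { digits = a ; admissible = adm ; current≤ = d≤ ; at = y≈ }
    point-enterBy d 1≤d (inj₂ d≡t) d≤ =
      point-append d (ℕ.≤-antisym d≤ (ℕ.≤-trans (adm 0) (ℕ.≤-reflexive (≡.sym d≡t))))

  -- The side of the gap is decided by comparing the leading digit with `current`; no comparison of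
  -- reals is involved.
  point-child : ∀ N {y} → PointAt N y → ∃[ b ] PointAt (child b N) y
  point-child N {y} P = case (ℕ.m≤n⇒m<n∨m≡n current≤) rising
    where
    open Point P
    open Node N using (matrix; state; rows; current<top)
    open Matrix matrix using (rising)
    d = Node.current N
    case : d ℕ.< head digits ⊎ d ≡ head digits → ∀ r →
           ∃[ b ] PointAt (if b xor r then lowDigit N else highDigits N) y
    case (inj₁ d<) true  = true  , point-enterBy matrix state rows digits admissible at _ _ (ℕ.m≤n⇒m<n∨m≡n current<top) d<
    case (inj₁ d<) false = false , point-enterBy matrix state rows digits admissible at _ _ (ℕ.m≤n⇒m<n∨m≡n current<top) d<
    case (inj₂ d≡) true  = false , point-append matrix state rows digits admissible at d d≡
    case (inj₂ d≡) false = true  , point-append matrix state rows digits admissible at d d≡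

  -- The digits determine a path, and membership of a vertex in it is decidable. Off the path, the
  -- vertex or one of its ancestors has a sibling containing y, and siblings are disjoint.
  point-or-outside : ∀ w {y} → PointAt (nodeAt []) y → PointAt (nodeAt w) y ⊎ y ∉ ⟦ interval w ⟧
  point-or-outside []      P = inj₁ P
  point-or-outside (b ∷ w) {y} P = case (point-or-outside w P)
    where
    sibling : ∀ b c → PointAt (child c (nodeAt w)) y → PointAt (child b (nodeAt w)) y ⊎ y ∉ ⟦ interval (b ∷ w) ⟧
    sibling false false Q = inj₁ Q
    sibling true  true  Q = inj₁ Q
    sibling false true  Q = inj₂ λ y∈ → siblings-disjoint [] [] w y∈ (point-inside (child true (nodeAt w)) Q)
    sibling true  false Q = inj₂ λ y∈ → siblings-disjoint [] [] w (point-inside (child false (nodeAt w)) Q) y∈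
    case : PointAt (nodeAt w) y ⊎ y ∉ ⟦ interval w ⟧ → PointAt (child b (nodeAt w)) y ⊎ y ∉ ⟦ interval (b ∷ w) ⟧
    case (inj₁ Q) = let c , Q′ = point-child (nodeAt w) Q in sibling b c Q′
    case (inj₂ y∉) = inj₂ λ y∈ → y∉ (child⊆ b w y∈)

  point∌gap : ∀ {y} → PointAt (nodeAt []) y → ∀ w → y ∉ ⟪ gap w ⟫
  point∌gap {y} P w = case (point-or-outside w P)
    where
    case : PointAt (nodeAt w) y ⊎ y ∉ ⟦ interval w ⟧ → y ∉ ⟪ gap w ⟫
    case (inj₁ Q) = let b , Q′ = point-child (nodeAt w) Q in
      descendant∌gap [] b w (point-inside (child b (nodeAt w)) Q′)
    case (inj₂ y∉) y∈ = y∉ (gap⊆interval w y∈)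

  log-value : ∀ a → head a ≡ 4 → head (tail a) ≡ 3 → ∀ 0<x →
              log (value a) 0<x ≈ coordinate rootMatrix (tail (tail a))
  log-value a a₀≡4 a₁≡3 0<x = trans
    (solve 2 (λ x y → x := (x :+ y) :- y) refl (log x 0<x) (log q 0<q))
    (trans (+-congʳ (trans (sym (log-* x q 0<x 0<q)) (log-cong (*-pos 0<x 0<q) 0<p xq≈p)))
      (sym (logMöbius-def rootMatrix t)))
    where
    x = value a
    t = valueᵖ (tail (tail a))
    p = numerator rootMatrix t
    q = denominator rootMatrix t
    0<p = numerator-pos rootMatrix t
    0<q = denominator-pos rootMatrix t
    x₁-step : Step 3 (proj₁ t) (value (tail a))
    x₁-step = ≡.subst (λ d → Step d (proj₁ t) (value (tail a))) a₁≡3 (value-step (tail a))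
    x-step : Step 4 (value (tail a)) x
    x-step = ≡.subst (λ d → Step d (value (tail a)) x) a₀≡4 (value-step a)
    combine : ∀ {x y t} → y * t ≈ fromℕ 3 * t + fromℕ 1 → x * y ≈ fromℕ 4 * y + fromℕ 1 →
              x * affine 3 1 t ≈ affine 13 4 t
    combine {x} {y} {t} yt≈ xy≈ = trans (*-congˡ (sym yt≈))
      (trans (sym (*-assoc x y t)) (trans (*-congʳ xy≈)
        (trans (solve 2 (λ y t → (con (+ 4) :* y :+ con (+ 1)) :* t := con (+ 4) :* (y :* t) :+ t) refl y t)
          (trans (+-congʳ (*-congˡ yt≈))
            (solve 1 (λ t → con (+ 4) :* (con (+ 3) :* t :+ con (+ 1)) :+ t := con (+ 13) :* t :+ con (+ 4)) refl t)))))
    xq≈p : x * q ≈ p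
    xq≈p = combine (Step.equation x₁-step) (Step.equation x-step)

  F₄*-point : ∀ {y} → y ∈ logImage F₄* → PointAt (nodeAt []) y
  F₄*-point {y} (x , 0<x , (_ , a , isF₄* , a→x) , y≈log) = record
    { digits      = tail (tail as)
    ; admissible  = ≡.subst (λ s → Admissible s (a ∘ ℕ.suc ∘ ℕ.suc)) state≡ (adm ∘ ℕ.suc ∘ ℕ.suc)
    ; current≤      = F.a≥1 2
    ; at = trans y≈log (trans (log-cong 0<x (value-pos as) (lim-unique a→x (value-expansion as)))
        (log-value as F.a₀≡4 F.a₁≡3 (value-pos as)))
    }
    where
    module F = F₄*-Digits isF₄*
    as : Digits
    as = record { digit = a ; ≥1 = F.a≥1 ; ≤4 = F.a≤4 }
    adm : Admissible free a
    adm = compatible⇒admissible free a F.a≤4 F.no-44 F.no-41414 tt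
    -- The leading 4 restricts what follows, but the 3 lifts the restriction, so the tail starts
    -- from `free`.
    state≡ : move (move free (a 0)) (a 1) ≡ free
    state≡ = ≡.cong₂ (λ d e → move (move free d) e) F.a₀≡4 F.a₁≡3

  module _ {y} (y∈I : y ∈ ⟦ interval [] ⟧) (y∉gaps : ∀ w → y ∉ ⟪ gap w ⟫) where

    open Search (λ w → y ∈ ⟦ interval w ⟧) (λ w y∈ → gap-avoided⇒child w y∈ (y∉gaps w))

    Close : ℕ → Carrier → Carrier → Set ℓ₂
    Close n x z = fromℕ n * (x - z) ≤ fromℕ 5 × fromℕ n * (z - x) ≤ fromℕ 5

    -- y and the continued fraction read off from it lie in the same interval of the tree, whose
    -- width is at most 5 / n.
    spot-close : ∀ {M s} (S : Spot M s) n → n ℕ.≤ Matrix.u M → Close n y (coordinate M (from S))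
    spot-close {M} {s} S n n≤u = bound (proj₁ y∈′) (proj₂ y∈′) (proj₁ z∈) (proj₂ z∈) ,
                                 bound (proj₁ z∈) (proj₂ z∈) (proj₁ y∈′) (proj₂ y∈′)
      where
      open Spot S
      N = freshNode M s rows
      y∈′ : nodeLo N ≤ y × y ≤ nodeHi N
      y∈′ = ≡.subst (λ N → nodeLo N ≤ y × y ≤ nodeHi N) at inside
      z∈ = point-inside N {coordinate M (from S)} record
        { digits = from S ; admissible = digitsFrom-admissible S ; current≤ = digitsFrom≥1 S 0 ; at = refl }
      width : fromℕ n * (nodeHi N - nodeLo N) ≤ fromℕ 5
      width = ≤-resp (*-congˡ (sym (upper-lower (Matrix.rising M)))) refl
        (logMöbius-width M {n} (startᵖ s 1) (highᵖ s) n≤u start∈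
          (≤5 (value-inRange (greatest s))) (<⇒≤ start<high))
        where
        start∈ : InRange (start s 1)
        start∈ = step-inRange ℕ.≤-refl (ℕ.s≤s ℕ.z≤n) (value-inRange (greatest (move s 1))) (start-step s 1)
        start<high : start s 1 < high s
        start<high = <-≤-trans (start<end s 1) (end≤high s (1≤top s))
      bound : ∀ {x z} → nodeLo N ≤ x → x ≤ nodeHi N → nodeLo N ≤ z → z ≤ nodeHi N →
              fromℕ n * (x - z) ≤ fromℕ 5
      bound {x} {z} lo≤x x≤hi lo≤z z≤hi = ≤-trans
        (*-monoˡ-≤ (fromℕ n) (fromℕ-nonneg n) (+-mono-≤ x≤hi (-‿mono-≤ lo≤z))) width

    -- A new digit leaves the coordinate unchanged and raises a common lower bound of u and v by at
    -- least 1. Both are tracked, because the rows are exchanged at each digit.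
    close-at-depth : ∀ k {M s} (S : Spot M s) m → m ℕ.≤ Matrix.u M → m ℕ.≤ Matrix.v M →
                     Close (m ℕ.+ k) y (coordinate M (from S))
    close-at-depth ℕ.zero {M} S m m≤u m≤v =
      spot-close S (m ℕ.+ 0) (ℕ.≤-trans (ℕ.≤-reflexive (ℕ.+-identityʳ m)) m≤u)
    close-at-depth (ℕ.suc k) {M} S m m≤u m≤v = transport
      (≡.subst (λ n → Close n y (coordinate (append M d) (from next))) (≡.sym (ℕ.+-suc m k))
        (close-at-depth k next (ℕ.suc m) (grow {v} 1≤v′ m≤v) (grow {u} 1≤u′ m≤u)))
      where
      open Choice (choice S)
      open Matrix M
      grow : ∀ {x x′} → 1 ℕ.≤ x′ → m ℕ.≤ x → ℕ.suc m ℕ.≤ x ℕ.* d ℕ.+ x′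
      grow {x} {x′} 1≤x′ m≤x = ℕ.≤-trans (ℕ.≤-reflexive (ℕ.+-comm 1 m)) (ℕ.+-mono-≤
        (ℕ.≤-trans m≤x (ℕ.≤-trans (ℕ.≤-reflexive (≡.sym (ℕ.*-identityʳ x))) (ℕ.*-monoʳ-≤ x 1≤d))) 1≤x′)
      same : coordinate (append M d) (from next) ≈ coordinate M (from S)
      same = coordinate-append M (from S) d ≡.refl
      transport : Close (m ℕ.+ ℕ.suc k) y (coordinate (append M d) (from next)) →
                  Close (m ℕ.+ ℕ.suc k) y (coordinate M (from S))
      transport (p , q) = ≤-resp (*-congˡ (+-congˡ (-‿cong same))) refl p , ≤-resp (*-congˡ (+-congʳ same)) refl q

    all-multiples-bounded⇒≤ : ∀ {x z b} → (∀ n → fromℕ n * (x - z) ≤ fromℕ b) → x ≤ z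
    all-multiples-bounded⇒≤ {x} {z} {b} bounded z<x =
      let n , b/ε<n = archimedean (fromℕ b * (x - z) ⁻¹[ 0<ε ]) in
      bounded n (<-resp (*-⁻¹-cancel (x - z) 0<ε (fromℕ b)) (*-comm (x - z) (fromℕ n))
        (*-monoˡ-< (x - z) 0<ε b/ε<n))
      where
      0<ε : 0# < x - z
      0<ε = x<y⇒0<y-x z<x

    rootSpot : Spot rootMatrix free
    rootSpot = record { rows = tt , tt ; w = [] ; at = ≡.refl ; inside = y∈I }

    y≈coordinate : y ≈ coordinate rootMatrix (from rootSpot)
    y≈coordinate = ≤-antisym
      (all-multiples-bounded⇒≤ {b = 5} λ n → proj₁ (close-at-depth n rootSpot 0 ℕ.z≤n ℕ.z≤n))
      (all-multiples-bounded⇒≤ {b = 5} λ n → proj₂ (close-at-depth n rootSpot 0 ℕ.z≤n ℕ.z≤n))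

    expansion : ℕ → ℕ
    expansion 0                   = 4
    expansion 1                   = 3
    expansion (ℕ.suc (ℕ.suc n)) = digitsFrom rootSpot n

    expansion-admissible : Admissible free expansion
    expansion-admissible 0                   = ℕ.≤-refl
    expansion-admissible 1                   = ℕ.≤-refl
    expansion-admissible (ℕ.suc (ℕ.suc n)) = digitsFrom-admissible rootSpot n

    expansion≥1 : ∀ n → 1 ℕ.≤ expansion n
    expansion≥1 0                   = ℕ.s≤s ℕ.z≤n
    expansion≥1 1                   = ℕ.s≤s ℕ.z≤n
    expansion≥1 (ℕ.suc (ℕ.suc n)) = digitsFrom≥1 rootSpot n

    expansion-digits : F₄*-Digits expansion
    expansion-digits = record
      { a₀≡4     = ≡.refl
      ; a₁≡3     = ≡.refl
      ; a≥1      = expansion≥1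
      ; a≤4      = λ n → ℕ.≤-trans (expansion-admissible n) (top≤4 (run free expansion n))
      ; no-44    = admissible-no-44 free expansion expansion-admissible
      ; no-41414 = admissible-no-41414 free expansion expansion-admissible
      }

    gaps-avoided⇒∈ : y ∈ logImage F₄*
    gaps-avoided⇒∈ = value a , value-pos a ,
      (value-irrational a , expansion , expansion-digits , value-expansion a) ,
      trans y≈coordinate (sym (log-value a ≡.refl ≡.refl (value-pos a)))
      where
      module F = F₄*-Digits expansion-digits
      a : Digits
      a = record { digit = expansion ; ≥1 = F.a≥1 ; ≤4 = F.a≤4 }

  thickness : ThicknessExceedsOne (logImage F₄*)
  thickness = τ , 1<τ , thicknessAtLeast
    (λ w → scale (boundˡ (nodeAt w) {101} {100} (proj₁ margins) (proj₂ margins)))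
    (λ w → scale (boundʳ (nodeAt w) {101} {100} (proj₁ margins) (proj₂ margins)))
    (λ y∈ → point-inside (nodeAt []) (F₄*-point y∈))
    (λ y∈ → point∌gap (F₄*-point y∈))
    gaps-avoided⇒∈
    where
    T S : Carrier
    T = fromℕ 101
    S = fromℕ 100
    0<S : 0# < S
    0<S = fromℕ-pos 100 (ℕ.s≤s ℕ.z≤n)
    τ : Carrier
    τ = T * S ⁻¹[ 0<S ]
    Sτ≈T : S * τ ≈ T
    Sτ≈T = *-⁻¹-cancel S 0<S T
    1<τ : 1# < τ
    1<τ = *-cancelˡ-< S 0<S (<-resp (sym (*-identityʳ S)) (sym Sτ≈T)
      (<-resp (+-identityˡ S) refl (+-monoˡ-< S 0<1)))
    scale : ∀ {x z} → T * x ≤ S * z → τ * x ≤ z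
    scale {x} Tx≤Sz = *-cancelˡ-≤ S 0<S (≤-resp (trans (*-congʳ (sym Sτ≈T)) (*-assoc S τ x)) refl Tx≤Sz)

theorem2p14 : ∀ {c ℓ₁ ℓ₂} (ℝ : RealField c ℓ₁ ℓ₂) (ln : NaturalLogarithm ℝ) → Thickness.ThicknessExceedsOne ℝ (NaturalLogarithm.logImage ln (ContinuedFractions.F₄* ℝ))
theorem2p14 ℝ ln = LogF₄*.thickness ln
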